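{- Let $\mathcal{G}=(H,\sigma,\alpha,h_0)$ be a rooted combinatorial map with underlying graph $G=(V,E)$ and root-vertex $v_0$. The mapping $\Lambda:T\mapsto\mathcal{S}_T$ is a bijection between the spanning trees of $G$ and the recurrent sandpile configurations of $G$ (with respect to the root-vertex $v_0$).
   Context: A rooted combinatorial map is $\mathcal{G}=(H,\sigma,\alpha,h_0)$ with $H$ a finite set of half-edges, $\sigma$ a permutation, $\alpha$ a fixed-point-free involution, $\langle\sigma,\alpha\rangle$ transitive on $H$, root $h_0$; underlying graph: vertices the cycles of $\sigma$, edges the pairs $\{h,\alpha(h)\}$, a half-edge being incident to the vertex containing it; $v_0$ is the vertex containing $h_0$. For a spanning tree $T$: edges in $T$ are internal, others external; the motion function $t(h)=\sigma\alpha(h)$ if the edge of $h$ is internal, $\sigma(h)$ otherwise, is a cyclic permutation of $H$; the $(\mathcal{G},T)$-order on $H$ is $h_0<t(h_0)<\dots<t^{|H|-1}(h_0)$, edges compared via their smaller half-edge. Fundamental cycle of external $e$: set of $e'$ with $T-e'+e$ a spanning tree; fundamental cocycle of internal $e$: set of $e'$ with $T-e+e'$ a spanning tree; an edge is $(\mathcal{G},T)$-active if minimal in its fundamental cycle/cocycle. The orientation $\mathcal{O}_T$ sets, for $e=\{h_1,h_2\}$ with $h_1<h_2$, tail $h_1$/head $h_2$ if $e$ is internal and tail $h_2$/head $h_1$ if external. $\mathcal{S}_T:V\to\mathbb{N}$ gives to $v$ the number of half-edges incident to $v$ that are tails in $\mathcal{O}_T$ plus the number of half-edges incident to $v$ that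 are heads in $\mathcal{O}_T$ belonging to external $(\mathcal{G},T)$-active edges. Sandpile model: a configuration is $\mathcal{S}:V\to\mathbb{N}$; $\deg(v)$ is the number of half-edges incident to $v$, $\deg(u,v)$ the number of edges joining $u\neq v$, $\deg(v,*)$ the number of non-loop edges at $v$. A vertex $v$ with $\mathcal{S}(v)\ge\deg(v)$ may topple, producing $\mathcal{S}'$ with $\mathcal{S}'(u)=\mathcal{S}(u)+\deg(u,v)$ for $u\ne v$ and $\mathcal{S}'(v)=\mathcal{S}(v)-\deg(v,*)$. $\mathcal{S}$ is stable if $\mathcal{S}(v)<\deg(v)$ for all $v\ne v_0$; it is recurrent if it is stable, $\mathcal{S}(v_0)=\deg(v_0)$, and there is a labeling $v_0,v_1,\dots,v_{|V|-1}$ of $V$ such that toppling $v_0,v_1,\dots,v_{|V|-1}$ in this order is a valid sequence of topplings leading back to $\mathcal{S}$. -}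

module Defs where

open import Data.Nat using (ℕ; zero; suc; _+_; _∸_; _≤_; _<_; _<ᵇ_)
open import Data.Nat.Properties using (_≟_)
open import Data.Bool using (Bool; true; false; if_then_else_; _∧_; _∨_; not)
open import Data.Fin using (Fin; toℕ)
import Data.Fin.Properties as FinP
open import Data.Fin.Permutation using (Permutation′; _⟨$⟩ʳ_)
open import Data.List using (List; []; _∷_; length; foldl; foldr; map; upTo; allFin)
open import Data.Nat.ListAction using (sum)
open import Data.Empty using (⊥)
open import Data.List.Relation.Unary.All using (All)
open import Data.List.Relation.Unary.Any using (Any)
open import Data.List.Relation.Unary.AllPairs using (AllPairs)
open import Data.List.Membership.Propositional using (_∈_)
open import Data.List.Relation.Unary.Unique.Propositional using (Unique)
open import Data.Product using (Σ; _×_; proj₁)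
open import Data.Sum using (_⊎_)
open import Data.Unit using (⊤)
open import Function.Bundles using (_⇔_)
open import Relation.Nullary using (¬_; does)
open import Relation.Binary.PropositionalEquality using (_≡_; _≢_)

infix 4 _==_
_==_ : ∀ {n} → Fin n → Fin n → Bool
x == y = does (x FinP.≟ y)

-- reachability by forward steps of σ and α (the group ⟨σ,α⟩ is finite,
-- so its orbits coincide with forward-reachability classes)
data Reach {n} (σ α : Fin n → Fin n) : Fin n → Fin n → Set where
  here  : ∀ {h} → Reach σ α h h
  stepσ : ∀ {h h'} → Reach σ α (σ h) h' → Reach σ α h h'
  stepα : ∀ {h h'} → Reach σ α (α h) h' → Reach σ α h h'

record RootedMap (n : ℕ) : Set where
  field
    σ     : Permutation′ n
    α     : Fin n → Fin n
    α-inv : ∀ h → α (α h) ≡ h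
    α-fpf : ∀ h → α h ≢ h
    trans : ∀ h h' → Reach (σ ⟨$⟩ʳ_) α h h'
    h₀    : Fin n

iter : ∀ {A : Set} → (A → A) → ℕ → A → A
iter f zero    x = x
iter f (suc k) x = f (iter f k x)

minFin : ∀ {n} → Fin n → Fin n → Fin n
minFin x y = if toℕ x <ᵇ toℕ y then x else y

countB : ∀ {n} → (Fin n → Bool) → ℕ
countB {n} p = sum (map (λ h → if p h then 1 else 0) (allFin n))

findFrom : (ℕ → Bool) → ℕ → ℕ → ℕ
findFrom f k zero       = k
findFrom f k (suc fuel) = if f k then k else findFrom f (suc k) fuel

module _ {n : ℕ} (M : RootedMap n) where
  open RootedMap M

  σf : Fin n → Fin n
  σf h = σ ⟨$⟩ʳ h

  -- vertices = cycles of σ; each vertex is represented by the least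
  -- half-edge (in Fin order) of its σ-cycle.  vtx h = vertex containing h.
  vtx : Fin n → Fin n
  vtx h = foldr (λ k m → minFin (iter σf k h) m) h (upTo n)

  V : Set
  V = Σ (Fin n) (λ h → vtx h ≡ h)

  IsRoot : V → Set
  IsRoot v = proj₁ v ≡ vtx h₀

  -- edges, subsets of edges (as α-closed boolean predicates on half-edges)

  SameEdge : Fin n → Fin n → Set
  SameEdge h h' = (h' ≡ h) ⊎ (h' ≡ α h)

  sameEdge? : Fin n → Fin n → Bool
  sameEdge? h h' = (h' == h) ∨ (h' == α h)

  EdgeSet : Set
  EdgeSet = Fin n → Bool

  data Walk (F : EdgeSet) : Fin n → Fin n → Set where
    stop : ∀ {u} → Walk F u u
    step : ∀ {u w} (h : Fin n) → F h ≡ true → vtx h ≡ u →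
           Walk F (vtx (α h)) w → Walk F u w

  Connected : EdgeSet → Set
  Connected F = ∀ h h' → Walk F (vtx h) (vtx h')

  WalkList : Fin n → List (Fin n) → Fin n → Set
  WalkList u []       w = u ≡ w
  WalkList u (h ∷ hs) w = (vtx h ≡ u) × WalkList (vtx (α h)) hs w

  Cycle : EdgeSet → List (Fin n) → Set
  Cycle F []       = ⊥
  Cycle F (h ∷ hs) =
    All (λ x → F x ≡ true) (h ∷ hs) ×
    WalkList (vtx h) (h ∷ hs) (vtx h) ×
    AllPairs (λ a b → ¬ SameEdge a b) (h ∷ hs) ×
    AllPairs (λ a b → vtx a ≢ vtx b) (h ∷ hs)

  Acyclic : EdgeSet → Set
  Acyclic F = ∀ hs → ¬ Cycle F hs

  IsSpanningTree : EdgeSet → Set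
  IsSpanningTree F = (∀ h → F h ≡ F (α h)) × Connected F × Acyclic F

  module _ (T : EdgeSet) where

    motion : Fin n → Fin n
    motion h = if T h then σf (α h) else σf h

    pos : Fin n → ℕ
    pos h = findFrom (λ k → iter motion k h₀ == h) 0 n

    -- edges compared via their smaller half-edge
    key : Fin n → ℕ
    key h = Data.Nat._⊓_ (pos h) (pos (α h))

    -- T - e' + e   (e, e' edges given by any of their half-edges)
    swap : Fin n → Fin n → EdgeSet
    swap e' e h = sameEdge? e h ∨ (T h ∧ not (sameEdge? e' h))

    -- external (G,T)-active edge (e minimal in its fundamental cycle)
    ExtActive : Fin n → Set
    ExtActive e = (T e ≡ false) ×
      (∀ e' → IsSpanningTree (swap e' e) → key e ≤ key e')

    isTail : Fin n → Bool
    isTail h = if T h then pos h <ᵇ pos (α h) else pos (α h) <ᵇ pos h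

    HasCount : (Fin n → Set) → ℕ → Set
    HasCount P k = Σ (List (Fin n)) λ xs →
      Unique xs × (∀ h → (h ∈ xs) ⇔ P h) × (length xs ≡ k)

  Config : Set
  Config = V → ℕ

  IsS_T : EdgeSet → Config → Set
  IsS_T T S = ∀ (v : V) → Σ ℕ λ a → Σ ℕ λ b →
    HasCount T (λ h → (vtx h ≡ proj₁ v) × (isTail T h ≡ true)) a ×
    HasCount T (λ h → (vtx h ≡ proj₁ v) × (isTail T h ≡ false) × ExtActive T h) b ×
    (S v ≡ a + b)

  deg : V → ℕ
  deg v = countB (λ h → vtx h == proj₁ v)

  -- number of edges joining u and v (for u ≠ v)
  degBetween : V → V → ℕ
  degBetween u v = countB (λ h → (vtx h == proj₁ u) ∧ (vtx (α h) == proj₁ v))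

  degStar : V → ℕ
  degStar v = countB (λ h → (vtx h == proj₁ v) ∧ not (vtx (α h) == proj₁ v))

  topple : Config → V → Config
  topple S v u = if proj₁ u == proj₁ v then S u ∸ degStar v
                 else S u + degBetween u v

  ValidTopplings : Config → List V → Set
  ValidTopplings S []       = ⊤
  ValidTopplings S (v ∷ vs) = (deg v ≤ S v) × ValidTopplings (topple S v) vs

  toppleAll : Config → List V → Config
  toppleAll = foldl topple

  Stable : Config → Set
  Stable S = ∀ v → ¬ IsRoot v → S v < deg v

  Recurrent : Config → Set
  Recurrent S = Stable S × (∀ v → IsRoot v → S v ≡ deg v) ×
    Σ V λ w → Σ (List V) λ ws →
      IsRoot w ×
      AllPairs (λ (a b : V) → proj₁ a ≢ proj₁ b) (w ∷ ws) ×
      (∀ (v : V) → Any (λ (x : V) → proj₁ x ≡ proj₁ v) (w ∷ ws)) ×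
      ValidTopplings S (w ∷ ws) ×
      (∀ v → toppleAll S (w ∷ ws) v ≡ S v)

{-# OPTIONS --safe #-}
module Submission where

open import Defs
open import Data.Nat using (ℕ; zero; suc; _+_; _∸_; _⊓_; _⊔_; _≤_; _<_; z≤n; s≤s; s≤s⁻¹; _<ᵇ_)
import Data.Nat.Properties as ℕ
open import Data.Bool using (Bool; true; false; if_then_else_; _∧_; _∨_; not; _xor_)
import Data.Bool.Properties as Bool
open import Data.Fin using (Fin; toℕ; fromℕ<)
import Data.Fin.Properties as Fin
open import Data.Fin.Permutation using (_⟨$⟩ˡ_; inverseˡ; inverseʳ)
open import Data.List using (List; []; _∷_; length; filter; foldr; map; upTo; allFin)
open import Data.Nat.ListAction using (sum)
open import Data.List.Relation.Unary.All as All using (All; []; _∷_)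
open import Data.List.Relation.Unary.Any using (Any; here; there)
open import Data.List.Relation.Unary.AllPairs using (AllPairs; []; _∷_)
open import Data.List.Membership.Propositional using (_∈_)
open import Data.List.Membership.Propositional.Properties using (∈-allFin; ∈-filter⁺; ∈-filter⁻; ∈-upTo⁺)
open import Data.List.Membership.Propositional.Properties.WithK using (unique∧set⇒bag)
open import Data.List.Relation.Binary.BagAndSetEquality using (∼bag⇒↭)
open import Data.List.Relation.Binary.Permutation.Propositional.Properties using (↭-length)
open import Data.List.Relation.Unary.Unique.Propositional using (Unique)
import Data.List.Relation.Unary.Unique.Propositional.Properties as Unique
open import Data.Product using (Σ; ∃; _×_; _,_; proj₁; proj₂)
open import Data.Sum using (_⊎_; inj₁; inj₂; [_,_]′)
open import Data.Empty using (⊥; ⊥-elim)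
open import Data.Unit using (tt)
open import Function.Base using (_∘_; id)
open import Function.Bundles using (_⇔_; Equivalence; mk⇔)
open import Level using (0ℓ)
open import Relation.Nullary using (¬_; Dec; does; yes; no; ¬?; contradiction; _×-dec_; _⊎-dec_)
open import Relation.Nullary.Decidable using (dec-true; dec-false; does-⇔)
open import Relation.Unary using (Pred; Decidable)
open import Relation.Binary.Definitions using (Tri; tri<; tri≈; tri>)
open import Relation.Binary.PropositionalEquality using (_≡_; _≢_; refl; sym; trans; cong; cong₂; subst; subst₂; module ≡-Reasoning)
open import Relation.Binary.PropositionalEquality.WithK using (≡-irrelevant)

-- Walk around T in the mirror map: q₀ = σ⁻¹ h₀, and q_{i+1} is σ⁻¹ of q_i, or of α q_i if the edge
-- of q_i is internal. This visits the half-edges in the reverse of the (G,T)-order, up to exchanging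
-- the two halves of each internal edge, so a half-edge is a tail of O_T iff it is met before its
-- opposite. Removing an internal edge splits T into two sides, and the walk crosses between them
-- only through that edge; hence the walk is one cycle and each side is an interval of it. It
-- follows that the heads at v that are not external active are exactly the half-edges at v whose
-- opposite is met before the walk first enters v. If ρ(v) is their number, then S_T = deg − ρ.
--
-- Toppling the vertices by time of entry shows that S_T is recurrent. Conversely ρ determines T
-- step by step: an edge met for the first time is internal iff it is the ρ(w)-th one met towards
-- its other end w. Running this rule on deg − S for a recurrent S is a depth-first form of Dhar's
-- burning algorithm; recurrence guarantees that it reaches every vertex.

-- Reversing the order makes the rule at an edge depend on the past alone: read in the (G,T)-order
-- itself, `ρ` would count half-edges whose opposite comes after the last visit to their vertex,
-- which is not yet known when the edge is met.
--
-- Trees are handled through cuts rather than cycles. A cut is a Boolean function on vertices that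
-- jumps along exactly one edge of the tree. Such functions can be followed along a walk or the tour
-- by induction and added modulo two, so exchange arguments need no surgery on paths. The
-- fundamental cycle of an external `k` becomes, besides `k`, the set of internal `g` whose cuts
-- jump at `k`. Explicit cycles occur only in the passage between cycles and cuts (`cuts⇒acyclic`,
-- `acyclic⇒cut`).
--
-- For surjectivity the edge set under construction is not known to be connected. The facts on the
-- tour are therefore layered: symmetry gives a periodic walk, cuts make it exhaust every vertex it
-- enters, and only then is full coverage assumed. Connectedness comes last, from coverage.

true≢false : true ≢ false
true≢false ()

true⊎false : ∀ b → b ≡ true ⊎ b ≡ false
true⊎false true  = inj₁ refl
true⊎false false = inj₂ refl

-- Counting

countIn : {A : Set} → (A → Bool) → List A → ℕ
countIn p xs = sum (map (λ x → if p x then 1 else 0) xs)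

module _ {A : Set} {P Q : Pred A 0ℓ} (P? : Decidable P) (Q? : Decidable Q) where

  countIn-mono : (∀ x → P x → Q x) → ∀ xs →
    countIn (does ∘ P?) xs ≤ countIn (does ∘ Q?) xs
  countIn-mono P⊆Q []       = z≤n
  countIn-mono P⊆Q (x ∷ xs) with P? x | Q? x
  ... | yes _  | yes _  = s≤s (countIn-mono P⊆Q xs)
  ... | yes px | no ¬qx = contradiction (P⊆Q x px) ¬qx
  ... | no _   | yes _  = ℕ.m≤n⇒m≤1+n (countIn-mono P⊆Q xs)
  ... | no _   | no _   = countIn-mono P⊆Q xs

  countIn-strict : (∀ x → P x → Q x) → ∀ {y} → ¬ P y → Q y → ∀ {xs} → y ∈ xs →
    countIn (does ∘ P?) xs < countIn (does ∘ Q?) xs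
  countIn-strict P⊆Q {y} ¬py qy {x ∷ xs} (here refl) with P? x | Q? x
  ... | yes px | _      = contradiction px ¬py
  ... | no _   | yes _  = s≤s (countIn-mono P⊆Q xs)
  ... | no _   | no ¬qx = contradiction qy ¬qx
  countIn-strict P⊆Q ¬py qy {x ∷ xs} (there y∈xs) with P? x | Q? x
  ... | yes _  | yes _  = s≤s (countIn-strict P⊆Q ¬py qy y∈xs)
  ... | yes px | no ¬qx = contradiction (P⊆Q x px) ¬qx
  ... | no _   | yes _  = ℕ.m≤n⇒m≤1+n (countIn-strict P⊆Q ¬py qy y∈xs)
  ... | no _   | no _   = countIn-strict P⊆Q ¬py qy y∈xs

  countIn-split : {R : Pred A 0ℓ} (R? : Decidable R) →
    (∀ x → R x → P x ⊎ Q x) → (∀ x → P x → R x) → (∀ x → Q x → R x) →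
    (∀ x → P x → ¬ Q x) → ∀ xs →
    countIn (does ∘ R?) xs ≡ countIn (does ∘ P?) xs + countIn (does ∘ Q?) xs
  countIn-split R? split P⊆R Q⊆R disj []       = refl
  countIn-split R? split P⊆R Q⊆R disj (x ∷ xs)
    with ih ← countIn-split R? split P⊆R Q⊆R disj xs | R? x | P? x | Q? x
  ... | _      | yes px | yes qx = contradiction qx (disj x px)
  ... | yes _  | yes _  | no _   = cong suc ih
  ... | yes _  | no _   | yes _  = trans (cong suc ih) (sym (ℕ.+-suc _ _))
  ... | yes rx | no ¬px | no ¬qx = contradiction (split x rx) [ ¬px , ¬qx ]′
  ... | no ¬rx | yes px | _      = contradiction (P⊆R x px) ¬rx
  ... | no ¬rx | _      | yes qx = contradiction (Q⊆R x qx) ¬rx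
  ... | no _   | no _   | no _   = ih

# : ∀ {n} {P : Pred (Fin n) 0ℓ} → Decidable P → ℕ
# P? = countB (does ∘ P?)

module _ {n : ℕ} {P Q : Pred (Fin n) 0ℓ} (P? : Decidable P) (Q? : Decidable Q) where

  #-mono : (∀ h → P h → Q h) → # P? ≤ # Q?
  #-mono P⊆Q = countIn-mono P? Q? P⊆Q (allFin n)

  #-strict : (∀ h → P h → Q h) → ∀ x → ¬ P x → Q x → # P? < # Q?
  #-strict P⊆Q x ¬px qx = countIn-strict P? Q? P⊆Q ¬px qx (∈-allFin x)

  #-split : {R : Pred (Fin n) 0ℓ} (R? : Decidable R) →
    (∀ h → R h → P h ⊎ Q h) → (∀ h → P h → R h) → (∀ h → Q h → R h) →
    (∀ h → P h → ¬ Q h) → # R? ≡ # P? + # Q?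
  #-split R? split P⊆R Q⊆R disj = countIn-split P? Q? R? split P⊆R Q⊆R disj (allFin n)

#-cong : ∀ {n} {P Q : Pred (Fin n) 0ℓ} (P? : Decidable P) (Q? : Decidable Q) →
  (∀ h → P h → Q h) → (∀ h → Q h → P h) → # P? ≡ # Q?
#-cong P? Q? P⊆Q Q⊆P = ℕ.≤-antisym (#-mono P? Q? P⊆Q) (#-mono Q? P? Q⊆P)

#-none : ∀ {n} {P : Pred (Fin n) 0ℓ} (P? : Decidable P) → (∀ h → ¬ P h) → # P? ≡ 0
#-none {n} {P} P? none = go (allFin n)
  where
  go : ∀ xs → countIn (does ∘ P?) xs ≡ 0
  go []       = refl
  go (x ∷ xs) with P? x
  ... | yes px = contradiction px (none x)
  ... | no _   = go xs

length-filter : {A : Set} {P : Pred A 0ℓ} (P? : Decidable P) (xs : List A) →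
  length (filter P? xs) ≡ countIn (does ∘ P?) xs
length-filter P? []       = refl
length-filter P? (x ∷ xs) with P? x
... | yes _ = cong suc (length-filter P? xs)
... | no _  = length-filter P? xs

module _ {n : ℕ} {P : Pred (Fin n) 0ℓ} (P? : Decidable P) where

  private
    P-list : List (Fin n)
    P-list = filter P? (allFin n)

    P-list-unique : Unique P-list
    P-list-unique = Unique.filter⁺ P? (Unique.allFin⁺ n)

    ∈P-list : ∀ h → (h ∈ P-list) ⇔ P h
    ∈P-list h = mk⇔ (λ h∈ → proj₂ (∈-filter⁻ P? {xs = allFin n} h∈)) (∈-filter⁺ P? (∈-allFin h))

  hasCount-# : (M : RootedMap n) (T : EdgeSet M) → HasCount M T P (# P?)
  hasCount-# M T = P-list , P-list-unique , ∈P-list , length-filter P? (allFin n)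

  -- `HasCount` only provides some duplicate-free list. Two such lists with the same members are
  -- permutations of each other, so the number is determined.
  unique-length≡# : ∀ {xs} → Unique xs → (∀ h → (h ∈ xs) ⇔ P h) → length xs ≡ # P?
  unique-length≡# {xs} u mem = trans
    (↭-length (∼bag⇒↭ (unique∧set⇒bag u P-list-unique
      (mk⇔ (λ h∈ → Equivalence.from (∈P-list _) (Equivalence.to (mem _) h∈))
           (λ h∈ → Equivalence.from (mem _) (Equivalence.to (∈P-list _) h∈))))))
    (length-filter P? (allFin n))

#-single : ∀ {n} (x : Fin n) → # (Fin._≟ x) ≡ 1
#-single x = sym (unique-length≡# (Fin._≟ x) {x ∷ []} ([] ∷ [])
  λ h → mk⇔ (λ { (here e) → e }) here)

#-insert : ∀ {n} {P Q : Pred (Fin n) 0ℓ} (P? : Decidable P) (Q? : Decidable Q) x →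
  (∀ h → Q h → P h ⊎ h ≡ x) → # Q? ≤ suc (# P?)
#-insert {P = P} P? Q? x Q⊆ = begin
  # Q?                   ≤⟨ #-mono Q? R? Q⊆ ⟩
  # R?                   ≡⟨ #-split P? D? R? split (λ _ → inj₁) (λ _ → inj₂ ∘ proj₁) (λ _ ph d → proj₂ d ph) ⟩
  # P? + # D?            ≤⟨ ℕ.+-monoʳ-≤ (# P?) (#-mono D? (Fin._≟ x) (λ _ → proj₁)) ⟩
  # P? + # (Fin._≟ x)    ≡⟨ cong (# P? +_) (#-single x) ⟩
  # P? + 1               ≡⟨ ℕ.+-comm (# P?) 1 ⟩
  suc (# P?)             ∎
  where
  open ℕ.≤-Reasoning
  R? : Decidable (λ h → P h ⊎ h ≡ x)
  R? h = P? h ⊎-dec (h Fin.≟ x)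
  D? : Decidable (λ h → h ≡ x × ¬ P h)
  D? h = (h Fin.≟ x) ×-dec ¬? (P? h)
  split : ∀ h → P h ⊎ h ≡ x → P h ⊎ (h ≡ x × ¬ P h)
  split h (inj₁ ph) = inj₁ ph
  split h (inj₂ e) with P? h
  ... | yes ph = inj₁ ph
  ... | no ¬ph = inj₂ (e , ¬ph)

-- Least elements and periods

least : {P : Pred ℕ 0ℓ} → Decidable P → ∀ m → P m →
  ∃ λ k → k ≤ m × P k × (∀ {j} → j < k → ¬ P j)
least P? zero    pm = 0 , z≤n , pm , λ ()
least P? (suc m) pm with P? 0
... | yes p0 = 0 , z≤n , p0 , λ ()
... | no ¬p0 with least (P? ∘ suc) m pm
... | k , k≤m , pk , min = suc k , s≤s k≤m , pk , λ { {zero} _ → ¬p0 ; {suc j} j<k → min (s≤s⁻¹ j<k) }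

findFrom-least : ∀ f d {k j} → f (k + j) ≡ true → (∀ i → i < j → f (k + i) ≡ false) →
  j < d → findFrom f k d ≡ k + j
findFrom-least f (suc d) {k} {zero}  fj min j<d with f k | subst (λ m → f m ≡ true) (ℕ.+-identityʳ k) fj
... | true | _ = sym (ℕ.+-identityʳ k)
findFrom-least f (suc d) {k} {suc j} fj min j<d
  with f k | subst (λ m → f m ≡ false) (ℕ.+-identityʳ k) (min 0 (s≤s z≤n))
... | false | _ = trans
  (findFrom-least f d (subst (λ m → f m ≡ true) (ℕ.+-suc k j) fj)
     (λ i i<j → subst (λ m → f m ≡ false) (ℕ.+-suc k i) (min (suc i) (s≤s i<j))) (s≤s⁻¹ j<d))
  (sym (ℕ.+-suc k j))

module _ {A : Set} (f : A → A) where

  iter-+ : ∀ a b x → iter f (a + b) x ≡ iter f a (iter f b x)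
  iter-+ zero    b x = refl
  iter-+ (suc a) b x = cong f (iter-+ a b x)

  iter-suc : ∀ a x → iter f (suc a) x ≡ iter f a (f x)
  iter-suc zero    x = refl
  iter-suc (suc a) x = cong f (iter-suc a x)

  iter-injective : (∀ {x y} → f x ≡ f y → x ≡ y) → ∀ a {x y} → iter f a x ≡ iter f a y → x ≡ y
  iter-injective inj zero    e = e
  iter-injective inj (suc a) e = iter-injective inj a (inj e)

module Period {n : ℕ} (f : Fin n → Fin n) (f-inj : ∀ {x y} → f x ≡ f y → x ≡ y) (x : Fin n) where

  -- Injectivity strips the common prefix from a repetition, so an orbit first repeats at its
  -- starting point.
  cancel : ∀ {i j} → i < j → iter f i x ≡ iter f j x → ∃ λ d → iter f (suc d) x ≡ x × suc d ≤ j
  cancel {i} {j} i<j e with j ∸ i | ℕ.m∸n+n≡m (ℕ.<⇒≤ i<j) | ℕ.m<n⇒0<n∸m i<j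
  ... | suc d | refl | _ = d ,
    sym (iter-injective f f-inj i (trans e
      (trans (cong (λ m → iter f m x) (ℕ.+-comm (suc d) i)) (iter-+ f i (suc d) x)))) ,
    ℕ.m≤m+n (suc d) i

  private
    returns : ∃ λ d → d < n × iter f (suc d) x ≡ x
    returns with Fin.pigeonhole (ℕ.n<1+n n) (λ i → iter f (toℕ i) x)
    ... | i , j , i<j , e with cancel i<j e
    ... | d , e′ , d<j = d , ℕ.<-≤-trans d<j (s≤s⁻¹ (Fin.toℕ<n j)) , e′

    least-return : ∃ λ k → k ≤ proj₁ returns × iter f (suc k) x ≡ x × (∀ {j} → j < k → iter f (suc j) x ≢ x)
    least-return = least (λ k → iter f (suc k) x Fin.≟ x) (proj₁ returns) (proj₂ (proj₂ returns))

  abstract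
    -- The period minus one, so that the period itself is visibly positive.
    p-1 : ℕ
    p-1 = proj₁ least-return

    p-1<n : p-1 < n
    p-1<n = ℕ.≤-<-trans (proj₁ (proj₂ least-return)) (proj₁ (proj₂ returns))

    periodic : iter f (suc p-1) x ≡ x
    periodic = proj₁ (proj₂ (proj₂ least-return))

    iter-distinct : ∀ {i j} → i < j → j ≤ p-1 → iter f i x ≢ iter f j x
    iter-distinct i<j j≤p e with cancel i<j e
    ... | d , e′ , d<j = proj₂ (proj₂ (proj₂ least-return)) (ℕ.<-≤-trans d<j j≤p) e′

  reduce : ∀ i → ∃ λ j → j ≤ p-1 × iter f j x ≡ iter f i x
  reduce zero    = 0 , z≤n , refl
  reduce (suc i) with reduce i
  ... | j , j≤p , e with j ℕ.≟ p-1
  ... | yes refl = 0 , z≤n , trans (sym periodic) (cong f e)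
  ... | no j≢p   = suc j , ℕ.≤∧≢⇒< j≤p j≢p , cong f e

  reduce-< : ∀ i → ∃ λ j → j < n × iter f j x ≡ iter f i x
  reduce-< i with reduce i
  ... | j , j≤p , e = j , ℕ.≤-<-trans j≤p p-1<n , e

  predecessor : ∀ i → ∃ λ j → f (iter f j x) ≡ iter f i x
  predecessor zero    = p-1 , periodic
  predecessor (suc i) = i , refl

private
  -- Used to add two cuts modulo two: along an edge where both jump, the sum does not.
  xor-differ : ∀ {a b c d : Bool} → a ≢ b → c ≢ d → a xor c ≡ b xor d
  xor-differ {b = b} a≢b c≢d with refl ← Bool.¬-not a≢b | refl ← Bool.¬-not c≢d with b
  ... | true  = refl
  ... | false = Bool.not-involutive _

  xor-cancelˡ : ∀ {a b c d : Bool} → a ≡ b → a xor c ≡ b xor d → c ≡ d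
  xor-cancelˡ {true}  refl e = Bool.not-injective e
  xor-cancelˡ {false} refl e = e

  xor-cancelʳ : ∀ {a b c d : Bool} → c ≡ d → a xor c ≡ b xor d → a ≡ b
  xor-cancelʳ {a} {b} {c} refl e =
    xor-cancelˡ {c} refl (trans (Bool.xor-comm c a) (trans e (Bool.xor-comm b c)))

  minFin≤ˡ : ∀ {n} (x y : Fin n) → toℕ (minFin x y) ≤ toℕ x
  minFin≤ˡ x y with toℕ x <ᵇ toℕ y in e
  ... | true  = ℕ.≤-refl
  ... | false = ℕ.≮⇒≥ λ x<y → true≢false (trans (sym (dec-true (toℕ x ℕ.<? toℕ y) x<y)) e)

  minFin≤ʳ : ∀ {n} (x y : Fin n) → toℕ (minFin x y) ≤ toℕ y
  minFin≤ʳ x y with toℕ x <ᵇ toℕ y | ℕ.<ᵇ⇒< (toℕ x) (toℕ y)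
  ... | true  | x<y = ℕ.<⇒≤ (x<y tt)
  ... | false | _   = ℕ.≤-refl

-- Vertices as cycles of σ

module Map {n : ℕ} (M : RootedMap n) where
  open RootedMap M hiding (trans) public

  s s⁻ ν : Fin n → Fin n
  s    = σf M
  s⁻ h = σ ⟨$⟩ˡ h
  ν    = vtx M

  s-s⁻ : ∀ h → s (s⁻ h) ≡ h
  s-s⁻ h = inverseʳ σ

  s⁻-s : ∀ h → s⁻ (s h) ≡ h
  s⁻-s h = inverseˡ σ

  s-injective : ∀ {x y} → s x ≡ s y → x ≡ y
  s-injective {x} {y} e = trans (sym (s⁻-s x)) (trans (cong s⁻ e) (s⁻-s y))

  s⁻-injective : ∀ {x y} → s⁻ x ≡ s⁻ y → x ≡ y
  s⁻-injective {x} {y} e = trans (sym (s-s⁻ x)) (trans (cong s e) (s-s⁻ y))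

  private
    module _ (h : Fin n) where
      orbitMin : List ℕ → Fin n
      orbitMin = foldr (λ k m → minFin (iter s k h) m) h

      orbitMin-≤ : ∀ {k ks} → k ∈ ks → toℕ (orbitMin ks) ≤ toℕ (iter s k h)
      orbitMin-≤ {ks = k ∷ ks} (here refl) = minFin≤ˡ (iter s k h) (orbitMin ks)
      orbitMin-≤ {ks = k ∷ ks} (there k∈)  =
        ℕ.≤-trans (minFin≤ʳ (iter s k h) (orbitMin ks)) (orbitMin-≤ k∈)

      orbitMin-orbit : ∀ ks → ∃ λ k → orbitMin ks ≡ iter s k h
      orbitMin-orbit []       = 0 , refl
      orbitMin-orbit (k ∷ ks) with toℕ (iter s k h) <ᵇ toℕ (orbitMin ks)
      ... | true  = k , refl
      ... | false = orbitMin-orbit ks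

  ν-orbit : ∀ h → ∃ λ k → ν h ≡ iter s k h
  ν-orbit h = orbitMin-orbit h (upTo n)

  -- `vtx` minimizes over the first `n` iterates only; the period is at most `n`, so these exhaust
  -- the cycle.
  ν-≤ : ∀ h k → toℕ (ν h) ≤ toℕ (iter s k h)
  ν-≤ h k with Period.reduce-< s s-injective h k
  ... | j , j<n , e = subst (λ x → toℕ (ν h) ≤ toℕ x) e (orbitMin-≤ h (∈-upTo⁺ j<n))

  -- Both minima range over the same cycle. Going back from `s h` to `h` is done by `p-1` further
  -- steps forward.
  ν-s : ∀ h → ν (s h) ≡ ν h
  ν-s h = Fin.toℕ-injective (ℕ.≤-antisym below above)
    where
    open Period s s-injective h
    above : toℕ (ν h) ≤ toℕ (ν (s h))
    above with ν-orbit (s h)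
    ... | k , e = subst (λ x → toℕ (ν h) ≤ toℕ x) (trans (iter-suc s k h) (sym e)) (ν-≤ h (suc k))
    below : toℕ (ν (s h)) ≤ toℕ (ν h)
    below with ν-orbit h
    ... | k , e = subst (λ x → toℕ (ν (s h)) ≤ toℕ x) same (ν-≤ (s h) (k + p-1))
      where
      same : iter s (k + p-1) (s h) ≡ ν h
      same = trans (iter-+ s k p-1 (s h))
        (trans (cong (iter s k) (trans (sym (iter-suc s p-1 h)) periodic)) (sym e))

  ν-s⁻ : ∀ h → ν (s⁻ h) ≡ ν h
  ν-s⁻ h = trans (sym (ν-s (s⁻ h))) (cong ν (s-s⁻ h))

  ν-iter : ∀ k h → ν (iter s k h) ≡ ν h
  ν-iter zero    h = refl
  ν-iter (suc k) h = trans (ν-s (iter s k h)) (ν-iter k h)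

  ν-idem : ∀ h → ν (ν h) ≡ ν h
  ν-idem h with ν-orbit h
  ... | k , e = trans (cong ν e) (ν-iter k h)

  -- Go forward from `h` to the common representative, then backward along the iterates of `h′`.
  same-vertex : (P : Pred (Fin n) 0ℓ) → (∀ h → P h → P (s h)) → (∀ h → P h → P (s⁻ h)) →
    ∀ {h h′} → ν h ≡ ν h′ → P h → P h′
  same-vertex P P-s P-s⁻ {h} {h′} e Ph with ν-orbit h | ν-orbit h′
  ... | k , ek | k′ , ek′ = back k′ (subst P (trans (sym ek) (trans e ek′)) (forth k))
    where
    forth : ∀ k → P (iter s k h)
    forth zero    = Ph
    forth (suc k) = P-s _ (forth k)
    back : ∀ k → P (iter s k h′) → P h′
    back zero    Pk = Pk
    back (suc k) Pk = back k (subst P (s⁻-s _) (P-s⁻ _ Pk))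

  -- Edges, cuts and components

  SameEdge′ : Fin n → Fin n → Set
  SameEdge′ = SameEdge M

  sameEdge : ∀ h x → Dec (SameEdge′ h x)
  sameEdge h x = (x Fin.≟ h) ⊎-dec (x Fin.≟ α h)

  sameEdge?-yes : ∀ {h x} → SameEdge′ h x → sameEdge? M h x ≡ true
  sameEdge?-yes {h} {x} = dec-true (sameEdge h x)

  sameEdge?-no : ∀ {h x} → ¬ SameEdge′ h x → sameEdge? M h x ≡ false
  sameEdge?-no {h} {x} = dec-false (sameEdge h x)

  minus⇒ : ∀ (F : EdgeSet M) {h x} → F x ∧ not (sameEdge? M h x) ≡ true → F x ≡ true × ¬ SameEdge′ h x
  minus⇒ F {h} {x} e = Bool.∧-conicalˡ (F x) _ e , λ same → true≢false
    (trans (sym e) (trans (cong (λ b → F x ∧ not b) (sameEdge?-yes same)) (Bool.∧-zeroʳ (F x))))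

  SameEdge-sym : ∀ {h x} → SameEdge′ h x → SameEdge′ x h
  SameEdge-sym     (inj₁ refl) = inj₁ refl
  SameEdge-sym {h} (inj₂ refl) = inj₂ (sym (α-inv h))

  SameEdge-trans : ∀ {h x y} → SameEdge′ h x → SameEdge′ x y → SameEdge′ h y
  SameEdge-trans     (inj₁ refl) e           = e
  SameEdge-trans     (inj₂ refl) (inj₁ refl) = inj₂ refl
  SameEdge-trans {h} (inj₂ refl) (inj₂ refl) = inj₁ (α-inv h)

  Sym : EdgeSet M → Set
  Sym F = ∀ h → F h ≡ F (α h)

  Sym-sameEdge : ∀ {F h x} → Sym F → SameEdge′ h x → F h ≡ F x
  Sym-sameEdge F-sym (inj₁ refl) = refl
  Sym-sameEdge F-sym (inj₂ refl) = F-sym _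

  Flat : (Fin n → Bool) → Fin n → Set
  Flat c h = c (ν h) ≡ c (ν (α h))

  Flat-α : ∀ {c h} → Flat c h → Flat c (α h)
  Flat-α {c} {h} e = trans (sym e) (cong (c ∘ ν) (sym (α-inv h)))

  Flat-sameEdge : ∀ {c h x} → SameEdge′ h x → Flat c h → Flat c x
  Flat-sameEdge         (inj₁ refl) e = e
  Flat-sameEdge {c} {h} (inj₂ refl) e = Flat-α {c} {h} e

  -- A cut of h in F: an indicator of one side of a bond meeting F only in h.
  Cut : EdgeSet M → Fin n → Set
  Cut F h = Σ (Fin n → Bool) λ c →
    (∀ g → F g ≡ true → ¬ SameEdge′ h g → Flat c g) × ¬ Flat c h

  walk-flat : ∀ {F} c → (∀ g → F g ≡ true → Flat c g) → ∀ {u w} → Walk M F u w → c u ≡ c w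
  walk-flat c flat stop              = refl
  walk-flat c flat (step h Fh refl W) = trans (flat h Fh) (walk-flat c flat W)

  connected-flat : ∀ {F} c → Connected M F → (∀ g → F g ≡ true → Flat c g) →
    ∀ g h → c (ν g) ≡ c (ν h)
  connected-flat c conn flat g h = walk-flat c flat (conn g h)

  -- The rest of a cycle through `h` leads from one end of `h` to the other over edges on which the
  -- cut of `h` is flat, so the cut could not jump at `h`.
  cuts⇒acyclic : ∀ {F} → (∀ h → F h ≡ true → Cut F h) → Acyclic M F
  cuts⇒acyclic {F} cuts (h ∷ hs) ((Fh ∷ Fhs) , (_ , walk) , (h≢hs ∷ _) , _) with cuts h Fh
  ... | c , flat , jump = jump (sym (along hs Fhs h≢hs walk))
    where
    along : ∀ {u w} gs → All (λ x → F x ≡ true) gs → All (λ b → ¬ SameEdge′ h b) gs →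
      WalkList M u gs w → c u ≡ c w
    along []       _          _          refl       = refl
    along (g ∷ gs) (Fg ∷ Fgs) (¬g ∷ ¬gs) (refl , W) = trans (flat g Fg ¬g) (along gs Fgs ¬gs W)

  -- Tailored to be closed into a `Cycle` by one edge at `w`: `avoids` keeps `w` off the starting
  -- points of the edges. The field `ends-in` serves to show that an edge put in front is new.
  record SimplePath (F : EdgeSet M) (χ : Fin n → Bool) (x w : Fin n) : Set where
    constructor simplePath
    field
      edges   : List (Fin n)
      walk    : WalkList M x edges w
      within  : All (λ b → F b ≡ true) edges
      ends-in : All (λ b → χ (ν b) ≡ true × χ (ν (α b)) ≡ true) edges
      avoids  : All (λ b → w ≢ ν b) edges
      edges-distinct    : AllPairs (λ a b → ¬ SameEdge′ a b) edges
      vertices-distinct : AllPairs (λ a b → ν a ≢ ν b) edges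

  record Component (F : EdgeSet M) (w : Fin n) : Set where
    field
      χ    : Fin n → Bool
      flat : ∀ g → F g ≡ true → Flat χ g
      path : ∀ x → χ x ≡ true → SimplePath F χ x w
      base : χ w ≡ true

  private
    module Grow (F : EdgeSet M) (F-sym : Sym F) (w : Fin n) where

      -- Adding one vertex at a time, by an edge into the part already reached, yields simple paths
      -- without shortening walks. Every round lowers the number of points outside `χ`, which the
      -- fuel bounds.
      grow : ∀ fuel (χ : Fin n → Bool) → # (λ x → χ x Bool.≟ false) < fuel → χ w ≡ true →
        (∀ x → χ x ≡ true → SimplePath F χ x w) → Component F w
      grow (suc fuel) χ bound χw path
        with Fin.any? (λ h → (F h Bool.≟ true) ×-dec ((χ (ν h) Bool.≟ false) ×-dec (χ (ν (α h)) Bool.≟ true)))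
      ... | no none = record { χ = χ ; flat = flat ; path = path ; base = χw }
        where
        flat : ∀ g → F g ≡ true → Flat χ g
        flat g Fg with χ (ν g) in e | χ (ν (α g)) in e′
        ... | true  | true  = refl
        ... | false | false = refl
        ... | false | true  = ⊥-elim (none (g , Fg , e , e′))
        ... | true  | false = ⊥-elim (none (α g , trans (sym (F-sym g)) Fg , e′ , trans (cong (χ ∘ ν) (α-inv g)) e))
      ... | yes (h , Fh , χh , χαh) = grow fuel χ′ bound′ (extend χw) path′
        where
        χ′ : Fin n → Bool
        χ′ x = χ x ∨ (x == ν h)
        extend : ∀ {x} → χ x ≡ true → χ′ x ≡ true
        extend {x} e = cong (_∨ (x == ν h)) e
        χ′h : χ′ (ν h) ≡ true
        χ′h = trans (cong (_∨ (ν h == ν h)) χh) (dec-true (ν h Fin.≟ ν h) refl)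
        bound′ : # (λ x → χ′ x Bool.≟ false) < fuel
        bound′ = ℕ.<-≤-trans
          (#-strict (λ x → χ′ x Bool.≟ false) (λ x → χ x Bool.≟ false)
            (λ x e → Bool.∨-conicalˡ _ _ e) (ν h)
            (λ e → true≢false (trans (sym χ′h) e)) χh)
          (s≤s⁻¹ bound)
        clash : ∀ {x} → x ≡ ν h → χ x ≢ true
        clash refl e = true≢false (trans (sym e) χh)
        path′ : ∀ x → χ′ x ≡ true → SimplePath F χ′ x w
        path′ x χ′x with χ x in e
        ... | true = record
          { SimplePath (path x e)
          ; ends-in = All.map (λ (p , p′) → extend p , extend p′) (SimplePath.ends-in (path x e)) }
        ... | false with x Fin.≟ ν h
        ... | yes refl = simplePath (h ∷ P.edges) (refl , P.walk) (Fh ∷ P.within)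
          ((χ′h , extend χαh) ∷ All.map (λ (p , p′) → extend p , extend p′) P.ends-in)
          ((λ w≡ → clash w≡ χw) ∷ P.avoids)
          -- The path has both ends of all its edges inside `χ`, while `h` starts outside, so `h`
          -- repeats neither an edge nor a vertex.
          (All.map (λ { (p , p′) (inj₁ refl) → clash refl p
                      ; (p , p′) (inj₂ refl) → clash (cong ν (α-inv h)) p′ }) P.ends-in ∷ P.edges-distinct)
          (All.map (λ (p , _) e′ → clash (sym e′) p) P.ends-in ∷ P.vertices-distinct)
          where module P = SimplePath (path (ν (α h)) χαh)

  component : ∀ F → Sym F → ∀ w → Component F w
  component F F-sym w = grow _ (_== w) (ℕ.n<1+n _) (dec-true (w Fin.≟ w) refl) start
    where
    open Grow F F-sym w
    start : ∀ x → (x == w) ≡ true → SimplePath F (_== w) x w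
    start x e with x Fin.≟ w
    ... | yes x≡w = simplePath [] x≡w [] [] [] [] []

  path⇒walk : ∀ {F χ x w} → SimplePath F χ x w → Walk M F x w
  path⇒walk {F} P = go (SimplePath.edges P) (SimplePath.walk P) (SimplePath.within P)
    where
    go : ∀ {x w} hs → WalkList M x hs w → All (λ b → F b ≡ true) hs → Walk M F x w
    go []       refl    _          = stop
    go (h ∷ hs) (e , W) (Fh ∷ Fhs) = step h Fh e (go hs W Fhs)

  -- Delete the edge of `h` and take the component of `ν h`. If it contained the other end of `h`, a
  -- simple path there together with `h` would be a cycle; hence its indicator is a cut.
  acyclic⇒cut : ∀ {F} → Sym F → Acyclic M F → ∀ h → F h ≡ true → Cut F h
  acyclic⇒cut {F} F-sym acyclic h Fh = cut
    where
    F′ : EdgeSet M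
    F′ x = F x ∧ not (sameEdge? M h x)
    ⇒F′ : ∀ {x} → F x ≡ true → ¬ SameEdge′ h x → F′ x ≡ true
    ⇒F′ {x} Fx ¬same = cong₂ _∧_ Fx (cong not (sameEdge?-no ¬same))
    F′-sym : Sym F′
    F′-sym x = Bool.⇔→≡ (mk⇔ (half x) (λ e → subst (λ y → F′ y ≡ true) (α-inv x) (half (α x) e)))
      where
      half : ∀ x → F′ x ≡ true → F′ (α x) ≡ true
      half x e with minus⇒ F e
      ... | Fx , ¬same = ⇒F′ (trans (sym (F-sym x)) Fx)
        λ same → ¬same (SameEdge-trans same (inj₂ (sym (α-inv x))))
    open Component (component F′ F′-sym (ν h))
    cut : Cut F h
    cut with χ (ν (α h)) in e
    ... | false = χ , (λ g Fg ¬same → flat g (⇒F′ Fg ¬same)) ,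
                  λ e′ → true≢false (trans (sym base) (trans e′ e))
    ... | true  = ⊥-elim (acyclic (h ∷ P.edges)
                    ( (Fh ∷ All.map (proj₁ ∘ minus⇒ F) P.within)
                    , (refl , P.walk)
                    , (All.map (proj₂ ∘ minus⇒ F) P.within ∷ P.edges-distinct)
                    , (P.avoids ∷ P.vertices-distinct)))
      where module P = SimplePath (path (ν (α h)) e)

  module _ (T : EdgeSet M) (g k : Fin n) where

    swap⇒ : ∀ {x} → swap M T g k x ≡ true → SameEdge′ k x ⊎ (T x ≡ true × ¬ SameEdge′ g x)
    swap⇒ {x} e with sameEdge k x
    ... | yes same = inj₁ same
    ... | no ¬same = inj₂ (minus⇒ T
      (trans (cong (_∨ (T x ∧ not (sameEdge? M g x))) (sym (sameEdge?-no ¬same))) e))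

    swap-new : ∀ {x} → SameEdge′ k x → swap M T g k x ≡ true
    swap-new {x} same = cong (_∨ (T x ∧ not (sameEdge? M g x))) (sameEdge?-yes same)

    swap-old : ∀ {x} → T x ≡ true → ¬ SameEdge′ g x → swap M T g k x ≡ true
    swap-old {x} Tx ¬same = trans
      (cong (sameEdge? M k x ∨_) (cong₂ _∧_ Tx (cong not (sameEdge?-no ¬same))))
      (Bool.∨-zeroʳ _)

    swap-sym : Sym T → Sym (swap M T g k)
    swap-sym T-sym x = Bool.⇔→≡ (mk⇔ (half x) (λ e → subst (λ y → swap M T g k y ≡ true) (α-inv x) (half (α x) e)))
      where
      half : ∀ x → swap M T g k x ≡ true → swap M T g k (α x) ≡ true
      half x e with swap⇒ e
      ... | inj₁ same = swap-new (SameEdge-trans same (inj₂ refl))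
      ... | inj₂ (Tx , ¬same) = swap-old (trans (sym (T-sym x)) Tx)
              λ same → ¬same (SameEdge-trans same (inj₂ (sym (α-inv x))))

  -- Both the indicator of a component of T − g + k and the cut of g are flat on T − g, and both
  -- jump at g, so their sum is flat on T, hence constant; but only the cut jumps at k.
  swap-spanning : ∀ {T} → IsSpanningTree M T → ∀ {g k} → T g ≡ true → T k ≡ false →
    (cut : Cut T g) → ¬ Flat (proj₁ cut) k → IsSpanningTree M (swap M T g k)
  swap-spanning {T} (T-sym , T-conn , T-acyc) {g} {k} Tg Tk (c , c-flat , c-jump) c-jumpk =
    F-sym , connected , cuts⇒acyclic cuts
    where
    F : EdgeSet M
    F = swap M T g k
    F-sym : Sym F
    F-sym = swap-sym T g k T-sym

    connected : Connected M F
    connected h h′ with component F F-sym (ν h′)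
    ... | record { χ = χ ; flat = flat ; path = path ; base = base } =
      path⇒walk (path (ν h) (trans (χ-const h) base))
      where
      flat-off-g : ∀ y → T y ≡ true → ¬ SameEdge′ g y → Flat χ y
      flat-off-g y Ty ¬same = flat y (swap-old T g k Ty ¬same)
      χ-const : ∀ x → χ (ν x) ≡ χ (ν h′)
      χ-const x with χ (ν g) Bool.≟ χ (ν (α g))
      ... | yes χ-g = connected-flat χ T-conn χ-flat x h′
        where
        χ-flat : ∀ y → T y ≡ true → Flat χ y
        χ-flat y Ty with sameEdge g y
        ... | yes same = Flat-sameEdge {χ} same χ-g
        ... | no ¬same = flat-off-g y Ty ¬same
      ... | no χ-jump = ⊥-elim (c-jumpk (xor-cancelˡ (flat k (swap-new T g k (inj₁ refl)))
                          (connected-flat d T-conn d-flat k (α k))))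
        where
        d : Fin n → Bool
        d y = χ y xor c y
        d-flat : ∀ y → T y ≡ true → Flat d y
        d-flat y Ty with sameEdge g y
        ... | yes same = Flat-sameEdge {d} same (xor-differ χ-jump c-jump)
        ... | no ¬same = cong₂ _xor_ (flat-off-g y Ty ¬same) (c-flat y Ty ¬same)

    cuts : ∀ x → F x ≡ true → Cut F x
    cuts x Fx with swap⇒ T g k Fx
    ... | inj₁ same = c , flat , λ e → c-jumpk (Flat-sameEdge {c} (SameEdge-sym same) e)
      where
      flat : ∀ y → F y ≡ true → ¬ SameEdge′ x y → Flat c y
      flat y Fy ¬same with swap⇒ T g k Fy
      ... | inj₁ same′         = ⊥-elim (¬same (SameEdge-trans (SameEdge-sym same) same′))
      ... | inj₂ (Ty , ¬same′) = c-flat y Ty ¬same′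
    -- The old cut `d` of `x` survives unless it jumps at the new edge `k`. In that case adding `c`
    -- repairs it: both jump at `k`, and `c` is flat at `x`.
    ... | inj₂ (Tx , ¬gx) with acyclic⇒cut T-sym T-acyc x Tx
    ... | d , d-flat , d-jump with d (ν k) Bool.≟ d (ν (α k))
    ... | yes d-flatk = d , flat , d-jump
      where
      flat : ∀ y → F y ≡ true → ¬ SameEdge′ x y → Flat d y
      flat y Fy ¬same with swap⇒ T g k Fy
      ... | inj₁ same     = Flat-sameEdge {d} same d-flatk
      ... | inj₂ (Ty , _) = d-flat y Ty ¬same
    ... | no d-jumpk = (λ y → d y xor c y) , flat , λ e → d-jump (xor-cancelʳ (c-flat x Tx ¬gx) e)
      where
      flat : ∀ y → F y ≡ true → ¬ SameEdge′ x y → Flat (λ y → d y xor c y) y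
      flat y Fy ¬same with swap⇒ T g k Fy
      ... | inj₁ same      = Flat-sameEdge {λ y → d y xor c y} same (xor-differ d-jumpk c-jumpk)
      ... | inj₂ (Ty , ¬g) = cong₂ _xor_ (d-flat y Ty ¬same) (c-flat y Ty ¬g)

  -- Were `e` external, the swapped set would contain `T`, and its cut of `k` would be flat on the
  -- connected `T`. Were a cut of `e` flat at `k`, it would be flat on the connected swapped set.
  -- Either way it would be constant and could not jump.
  spanning-swap : ∀ {T} → IsSpanningTree M T → ∀ {e k} → T k ≡ false →
    IsSpanningTree M (swap M T e k) → T e ≡ true × (∀ (cut : Cut T e) → ¬ Flat (proj₁ cut) k)
  spanning-swap {T} (T-sym , T-conn , T-acyc) {e} {k} Tk (F-sym , F-conn , F-acyc) = Te , jump
    where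
    F : EdgeSet M
    F = swap M T e k
    Te : T e ≡ true
    Te with T e in eq
    ... | true  = refl
    ... | false with acyclic⇒cut F-sym F-acyc k (swap-new T e k (inj₁ refl))
    ... | c , c-flat , c-jump = ⊥-elim (c-jump (connected-flat c T-conn flat k (α k)))
      where
      T-neq : ∀ {y z} → T z ≡ true → T y ≡ false → ¬ SameEdge′ y z
      T-neq Tz Ty same = true≢false (trans (sym Tz) (trans (sym (Sym-sameEdge T-sym same)) Ty))
      flat : ∀ y → T y ≡ true → Flat c y
      flat y Ty = c-flat y (swap-old T e k Ty (T-neq Ty eq)) (T-neq Ty Tk)
    jump : ∀ (cut : Cut T e) → ¬ Flat (proj₁ cut) k
    jump (c , c-flat , c-jump) e-flat = c-jump (connected-flat c F-conn flat e (α e))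
      where
      flat : ∀ y → F y ≡ true → Flat c y
      flat y Fy with swap⇒ T e k Fy
      ... | inj₁ same         = Flat-sameEdge {c} same e-flat
      ... | inj₂ (Ty , ¬same) = c-flat y Ty ¬same

-- The tour around an edge set in the mirror map

module Tour {n : ℕ} (M : RootedMap n) (T : EdgeSet M) where
  open Map M

  φ : Fin n → Fin n
  φ h = if T h then α h else h

  m : Fin n → Fin n
  m h = s⁻ (φ h)

  q : ℕ → Fin n
  q i = iter m i (s⁻ h₀)

  φ-internal : ∀ {h} → T h ≡ true → φ h ≡ α h
  φ-internal {h} Th = cong (λ b → if b then α h else h) Th

  φ-external : ∀ {h} → T h ≡ false → φ h ≡ h
  φ-external {h} Th = cong (λ b → if b then α h else h) Th

  step-internal : ∀ j → T (q j) ≡ true → ν (q (suc j)) ≡ ν (α (q j))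
  step-internal j Tq = trans (ν-s⁻ _) (cong ν (φ-internal Tq))

  step-external : ∀ j → T (q j) ≡ false → ν (q (suc j)) ≡ ν (q j)
  step-external j Tq = trans (ν-s⁻ _) (cong ν (φ-external Tq))

  step-flat : ∀ c j → (T (q j) ≡ true → Flat c (q j)) → c (ν (q (suc j))) ≡ c (ν (q j))
  step-flat c j flat with true⊎false (T (q j))
  ... | inj₁ e = trans (cong c (step-internal j e)) (sym (flat e))
  ... | inj₂ e = cong c (step-external j e)

  Seen : Fin n → Set
  Seen h = ∃ λ i → q i ≡ h

  module Orbit (T-sym : Sym T) where

    φ-φ : ∀ h → φ (φ h) ≡ h
    φ-φ h with true⊎false (T h)
    ... | inj₁ e = trans (cong φ (φ-internal e)) (trans (φ-internal (trans (sym (T-sym h)) e)) (α-inv h))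
    ... | inj₂ e = trans (cong φ (φ-external e)) (φ-external e)

    m-injective : ∀ {x y} → m x ≡ m y → x ≡ y
    m-injective {x} {y} e = trans (sym (φ-φ x)) (trans (cong φ (s⁻-injective e)) (φ-φ y))

    open Period m m-injective (s⁻ h₀) public

    -- Stated for any symmetric set with cuts, because `Burning` needs these facts for a forest
    -- before it is known to span.
    module Closed (cuts : ∀ h → T h ≡ true → Cut T h) where

      -- A tour that crosses a bond must cross it back, through its only internal edge.
      seen-α : ∀ {h} → T h ≡ true → Seen h → Seen (α h)
      seen-α {h} Th (i , qi≡h) with ℕ.anyUpTo? (λ j → q j Fin.≟ α h) (suc p-1)
      ... | yes (j , _ , e) = j , e
      ... | no never with cuts h Th
      ... | c , flat , jump = ⊥-elim (jump (trans (cong (c ∘ ν) (sym back)) (beyond p-1)))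
        where
        unseen : ∀ j → q j ≢ α h
        unseen j e with reduce j
        ... | j′ , j′≤ , e′ = never (j′ , s≤s j′≤ , trans e′ e)
        beyond : ∀ j → c (ν (q (suc j + i))) ≡ c (ν (α h))
        beyond zero    = cong c (trans (step-internal i (trans (cong T qi≡h) Th)) (cong (ν ∘ α) qi≡h))
        beyond (suc j) = trans (step-flat c (suc j + i) flat′) (beyond j)
          where
          flat′ : T (q (suc j + i)) ≡ true → Flat c (q (suc j + i))
          flat′ Tq = flat _ Tq λ
            { (inj₁ e) → jump (trans (cong (c ∘ ν) (sym e)) (beyond j))
            ; (inj₂ e) → unseen (suc j + i) e }
        back : q (suc p-1 + i) ≡ h
        back = trans (cong q (ℕ.+-comm (suc p-1) i))
          (trans (iter-+ m i (suc p-1) (s⁻ h₀)) (trans (cong (iter m i) periodic) qi≡h))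

      seen-s⁻ : ∀ h → Seen h → Seen (s⁻ h)
      seen-s⁻ h (i , e) with true⊎false (T h)
      ... | inj₂ Th = suc i , cong s⁻ (trans (cong φ e) (φ-external Th))
      ... | inj₁ Th with seen-α Th (i , e)
      ... | j , e′ = suc j , cong s⁻ (trans (cong φ e′) (trans (φ-internal (trans (sym (T-sym h)) Th)) (α-inv h)))

      -- The predecessor of `h` on the tour is `φ (s h)`, which is `s h` or its opposite; in the
      -- second case `seen-α` helps.
      seen-s : ∀ h → Seen h → Seen (s h)
      seen-s h (i , e) with predecessor i
      ... | j , e′ = conclude
        where
        qj : q j ≡ φ (s h)
        qj = m-injective (trans e′ (trans e (trans (sym (s⁻-s h)) (cong s⁻ (sym (φ-φ (s h)))))))
        conclude : Seen (s h)
        conclude with true⊎false (T (s h))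
        ... | inj₂ Tsh = j , trans qj (φ-external Tsh)
        ... | inj₁ Tsh = subst Seen (α-inv (s h)) (seen-α (trans (sym (T-sym (s h))) Tsh)
                        (j , trans qj (φ-internal Tsh)))

      seen-vertex : ∀ {h h′} → ν h ≡ ν h′ → Seen h → Seen h′
      seen-vertex = same-vertex Seen seen-s seen-s⁻

      connected⇒seen : Connected M T → ∀ h → Seen h
      connected⇒seen conn h = along (conn (q 0) h) (0 , refl) refl refl
        where
        along : ∀ {u w} → Walk M T u w → ∀ {g} → Seen g → ν g ≡ u → ν h ≡ w → Seen h
        along stop              seen eg eh = seen-vertex (trans eg (sym eh)) seen
        along (step x Tx ex W) seen eg eh =
          along W (seen-α Tx (seen-vertex (trans eg (sym ex)) seen)) refl eh

      module Full (all-seen : ∀ h → Seen h) where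

        private
          index : ∀ h → ∃ λ j → j ≤ p-1 × q j ≡ h
          index h with all-seen h
          ... | i , e with reduce i
          ... | j , j≤ , e′ = j , j≤ , trans e′ e

        abstract
          Q : Fin n → ℕ
          Q h = proj₁ (index h)

          Q≤ : ∀ h → Q h ≤ p-1
          Q≤ h = proj₁ (proj₂ (index h))

          q-Q : ∀ h → q (Q h) ≡ h
          q-Q h = proj₂ (proj₂ (index h))

        Q-injective : ∀ {x y} → Q x ≡ Q y → x ≡ y
        Q-injective {x} {y} e = trans (sym (q-Q x)) (trans (cong q e) (q-Q y))

        Q-q : ∀ {i} → i ≤ p-1 → Q (q i) ≡ i
        Q-q {i} i≤ with ℕ.<-cmp (Q (q i)) i
        ... | tri≈ _ e _ = e
        ... | tri< l _ _ = ⊥-elim (iter-distinct l i≤ (q-Q (q i)))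
        ... | tri> _ _ g = ⊥-elim (iter-distinct g (Q≤ (q i)) (sym (q-Q (q i))))

        Q-unique : ∀ {i h} → i ≤ p-1 → q i ≡ h → Q h ≡ i
        Q-unique i≤ refl = Q-q i≤

        n≡period : n ≡ suc p-1
        n≡period = ℕ.≤-antisym (Fin.injective⇒≤ {f = λ h → fromℕ< (s≤s (Q≤ h))} λ {x} {y} e →
          Q-injective (trans (sym (Fin.toℕ-fromℕ< (s≤s (Q≤ x)))) (trans (cong toℕ e) (Fin.toℕ-fromℕ< (s≤s (Q≤ y))))))
          p-1<n

        Q-α : ∀ h → Q (α h) ≢ Q h
        Q-α h e = α-fpf h (Q-injective e)

        constant : ∀ c a d → (∀ j → a ≤ j → j < d + a → T (q j) ≡ true → Flat c (q j)) →
          c (ν (q (d + a))) ≡ c (ν (q a))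
        constant c a zero    flat = refl
        constant c a (suc d) flat = trans
          (step-flat c (d + a) (flat (d + a) (ℕ.m≤n+m a d) ℕ.≤-refl))
          (constant c a d λ j a≤j j< → flat j a≤j (ℕ.m≤n⇒m≤1+n j<))

        constant-on : ∀ c {a b} → a ≤ b → (∀ j → a ≤ j → j < b → T (q j) ≡ true → Flat c (q j)) →
          c (ν (q b)) ≡ c (ν (q a))
        constant-on c {a} {b} a≤b flat = subst (λ b → c (ν (q b)) ≡ c (ν (q a))) (ℕ.m∸n+n≡m a≤b)
          (constant c a (b ∸ a) λ j a≤j j< → flat j a≤j (subst (j <_) (ℕ.m∸n+n≡m a≤b) j<))

        -- The far side of `g` is visited exactly at the times after `Q g` up to and including
        -- `Q (α g)`. The tour stands at `g` still on the near side and crosses in the next step;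
        -- likewise it stands at `α g` still on the far side.
        module Interval {g : Fin n} (Tg : T g ≡ true) (tail : Q g < Q (α g)) (cut : Cut T g) where

          c : Fin n → Bool
          c = proj₁ cut

          private
            flat-at : ∀ {j} → j ≤ p-1 → j ≢ Q g → j ≢ Q (α g) → T (q j) ≡ true → Flat c (q j)
            flat-at j≤ j≢g j≢αg Tq = proj₁ (proj₂ cut) _ Tq λ
              { (inj₁ e) → j≢g (sym (Q-unique j≤ e)) ; (inj₂ e) → j≢αg (sym (Q-unique j≤ e)) }

          before : ∀ {i} → i ≤ Q g → c (ν (q i)) ≡ c (ν g)
          before {i} i≤ = trans (sym (constant-on c i≤ λ j _ j<g →
            flat-at (ℕ.≤-trans (ℕ.<⇒≤ j<g) (Q≤ g)) (ℕ.<⇒≢ j<g) (ℕ.<⇒≢ (ℕ.<-trans j<g tail))))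
            (cong (c ∘ ν) (q-Q g))

          after : ∀ {i} → Q (α g) < i → i ≤ p-1 → c (ν (q i)) ≡ c (ν g)
          after {i} αg<i i≤ = trans (constant-on c αg<i λ j αg<j j<i →
            flat-at (ℕ.≤-trans (ℕ.<⇒≤ j<i) i≤) (ℕ.>⇒≢ (ℕ.<-trans tail αg<j)) (ℕ.>⇒≢ αg<j))
            (cong c (trans (step-internal (Q (α g)) (trans (cong T (q-Q (α g))) (trans (sym (T-sym g)) Tg)))
                           (cong ν (trans (cong α (q-Q (α g))) (α-inv g)))))

          between : ∀ {i} → Q g < i → i ≤ Q (α g) → c (ν (q i)) ≡ c (ν (α g))
          between {i} g<i i≤ = trans (sym (constant-on c i≤ λ j i≤j j<αg →
            flat-at (ℕ.≤-trans (ℕ.<⇒≤ j<αg) (Q≤ (α g))) (ℕ.>⇒≢ (ℕ.<-≤-trans g<i i≤j)) (ℕ.<⇒≢ j<αg)))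
            (cong (c ∘ ν) (q-Q (α g)))

          inside : ∀ h → c (ν h) ≢ c (ν g) → Q g < Q h × Q h ≤ Q (α g)
          inside h h-in =
            ℕ.≰⇒> (λ h≤g → h-in (trans (cong (c ∘ ν) (sym (q-Q h))) (before h≤g))) ,
            ℕ.≮⇒≥ (λ αg<h → h-in (trans (cong (c ∘ ν) (sym (q-Q h))) (after αg<h (Q≤ h))))

          αg-in : c (ν (α g)) ≢ c (ν g)
          αg-in e = proj₂ (proj₂ cut) (sym e)

        private
          first : ∀ k → ∃ λ i → i ≤ Q k × ν (q i) ≡ ν k × (∀ {j} → j < i → ν (q j) ≢ ν k)
          first k = least (λ i → ν (q i) Fin.≟ ν k) (Q k) (cong ν (q-Q k))

        abstract
          firstVisit : Fin n → ℕ
          firstVisit k = proj₁ (first k)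

          firstVisit-visits : ∀ k → ν (q (firstVisit k)) ≡ ν k
          firstVisit-visits k = proj₁ (proj₂ (proj₂ (first k)))

          firstVisit-≤ : ∀ {i k} → ν (q i) ≡ ν k → firstVisit k ≤ i
          firstVisit-≤ {k = k} e = ℕ.≮⇒≥ λ i< → proj₂ (proj₂ (proj₂ (first k))) i< e

        firstVisit-≤Q : ∀ {h k} → ν h ≡ ν k → firstVisit k ≤ Q h
        firstVisit-≤Q {h} e = firstVisit-≤ (trans (cong ν (q-Q h)) e)

        firstVisit-≤p : ∀ k → firstVisit k ≤ p-1
        firstVisit-≤p k = ℕ.≤-trans (firstVisit-≤Q refl) (Q≤ k)

        firstVisit-cong : ∀ {h k} → ν h ≡ ν k → firstVisit h ≡ firstVisit k
        firstVisit-cong {h} {k} e = ℕ.≤-antisym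
          (firstVisit-≤ (trans (firstVisit-visits k) (sym e))) (firstVisit-≤ (trans (firstVisit-visits h) e))

        firstVisit-root : ∀ k → ν k ≡ ν h₀ → firstVisit k ≡ 0
        firstVisit-root k e = ℕ.n≤0⇒n≡0 (firstVisit-≤ (trans (ν-s⁻ h₀) (sym e)))

        firstVisit-zero : ∀ k → firstVisit k ≡ 0 → ν k ≡ ν h₀
        firstVisit-zero k e = trans (sym (firstVisit-visits k)) (trans (cong (ν ∘ q) e) (ν-s⁻ h₀))

        -- The step after `g` reaches the far end, and up to time `Q g` the tour has stayed on the
        -- near side.
        firstVisit-child : ∀ {g} → T g ≡ true → Q g < Q (α g) → firstVisit (α g) ≡ suc (Q g)
        firstVisit-child {g} Tg tail = ℕ.≤-antisym
          (firstVisit-≤ (trans (step-internal (Q g) (trans (cong T (q-Q g)) Tg)) (cong (ν ∘ α) (q-Q g))))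
          (ℕ.≰⇒> λ early → αg-in (trans (cong c (sym (firstVisit-visits (α g)))) (before early)))
          where open Interval Tg tail (cuts g Tg)

        record Parent (k g : Fin n) : Set where
          field
            internal  : T g ≡ true
            to        : ν (α g) ≡ ν k
            tail      : Q g < Q (α g)

        -- A step over an external edge stays at its vertex, so a first arrival must use an internal
        -- edge. Its opposite half lies at the vertex just entered and is therefore met later.
        parent : ∀ {i} k → firstVisit k ≡ suc i → Q (q i) ≡ i × Parent k (q i)
        parent {i} k e = Qqi , record { internal = Tq ; to = to ; tail = tail }
          where
          arrive : ν (q (suc i)) ≡ ν k
          arrive = subst (λ j → ν (q j) ≡ ν k) e (firstVisit-visits k)
          Qqi : Q (q i) ≡ i
          Qqi = Q-q (ℕ.≤-trans (ℕ.n≤1+n i) (subst (_≤ p-1) e (firstVisit-≤p k)))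
          Tq : T (q i) ≡ true
          Tq with true⊎false (T (q i))
          ... | inj₁ int = int
          ... | inj₂ ext = ⊥-elim (ℕ.<-irrefl refl (subst (_≤ i) e
                          (firstVisit-≤ (trans (sym (step-external i ext)) arrive))))
          to : ν (α (q i)) ≡ ν k
          to = trans (sym (step-internal i Tq)) arrive
          tail : Q (q i) < Q (α (q i))
          tail = subst (_≤ Q (α (q i))) (trans e (cong suc (sym Qqi))) (firstVisit-≤Q to)

-- Orientation and activity in terms of tour times

private
  ∸-<ᵇ : ∀ {N a b} → a ≤ N → b ≤ N → (N ∸ a <ᵇ N ∸ b) ≡ (b <ᵇ a)
  ∸-<ᵇ {N} {a} {b} a≤N b≤N with b ℕ.<? a
  ... | yes b<a = trans (dec-true (N ∸ a ℕ.<? N ∸ b) (ℕ.∸-monoʳ-< b<a a≤N))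
                        (sym (dec-true (b ℕ.<? a) b<a))
  ... | no ¬b<a = trans (dec-false (N ∸ a ℕ.<? N ∸ b) (ℕ.≤⇒≯ (ℕ.∸-monoʳ-≤ N (ℕ.≮⇒≥ ¬b<a))))
                        (sym (dec-false (b ℕ.<? a) ¬b<a))

module SpanningTree {n : ℕ} (M : RootedMap n) (T : EdgeSet M) (tree : IsSpanningTree M T) where
  open Map M
  open Tour M T public

  T-sym : Sym T
  T-sym = proj₁ tree

  T-conn : Connected M T
  T-conn = proj₁ (proj₂ tree)

  cuts : ∀ h → T h ≡ true → Cut T h
  cuts = acyclic⇒cut T-sym (proj₂ (proj₂ tree))

  open Orbit T-sym public
  open Closed cuts public
  open Full (connected⇒seen T-conn) public

  Q<n : ∀ h → Q h < n
  Q<n h = subst (Q h <_) (sym n≡period) (s≤s (Q≤ h))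

  Q-unique-< : ∀ {i h} → i < n → q i ≡ h → Q h ≡ i
  Q-unique-< {i} i<n = Q-unique (s≤s⁻¹ (subst (i <_) n≡period i<n))

  -- The motion is `s` after `φ`, the tour iterates `s⁻` after `φ`, and `φ` is an involution. Hence
  -- conjugation by `φ` turns the tour into the inverse motion.
  iter-motion : ∀ k → k ≤ p-1 → iter (motion M T) k h₀ ≡ φ (q (p-1 ∸ k))
  iter-motion zero    _   = sym (s⁻-injective periodic)
  iter-motion (suc k) k<p = begin
    motion M T (iter (motion M T) k h₀)        ≡⟨ cong (motion M T) (iter-motion k (ℕ.<⇒≤ k<p)) ⟩
    motion M T (φ (q (p-1 ∸ k)))               ≡⟨ motion-φ (φ (q (p-1 ∸ k))) ⟩
    s (φ (φ (q (p-1 ∸ k))))                    ≡⟨ cong s (φ-φ (q (p-1 ∸ k))) ⟩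
    s (q (p-1 ∸ k))                            ≡⟨ cong (s ∘ q) (ℕ.+-∸-assoc 1 k<p) ⟩
    s (s⁻ (φ (q (p-1 ∸ suc k))))               ≡⟨ s-s⁻ _ ⟩
    φ (q (p-1 ∸ suc k))                        ∎
    where
    open ≡-Reasoning
    motion-φ : ∀ h → motion M T h ≡ s (φ h)
    motion-φ h with T h
    ... | true  = refl
    ... | false = refl

  pos≡ : ∀ h → pos M T h ≡ p-1 ∸ Q (φ h)
  pos≡ h = findFrom-least (λ k → iter (motion M T) k h₀ == h) n {0}
    (dec-true (_ Fin.≟ h) hit) miss
    (subst (p-1 ∸ Q (φ h) <_) (sym n≡period) (s≤s (ℕ.m∸n≤m p-1 (Q (φ h)))))
    where
    hit : iter (motion M T) (p-1 ∸ Q (φ h)) h₀ ≡ h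
    hit = begin
      iter (motion M T) (p-1 ∸ Q (φ h)) h₀    ≡⟨ iter-motion _ (ℕ.m∸n≤m p-1 (Q (φ h))) ⟩
      φ (q (p-1 ∸ (p-1 ∸ Q (φ h))))           ≡⟨ cong (φ ∘ q) (ℕ.m∸[m∸n]≡n (Q≤ (φ h))) ⟩
      φ (q (Q (φ h)))                         ≡⟨ cong φ (q-Q (φ h)) ⟩
      φ (φ h)                                 ≡⟨ φ-φ h ⟩
      h                                       ∎
      where open ≡-Reasoning
    miss : ∀ i → i < p-1 ∸ Q (φ h) → (iter (motion M T) i h₀ == h) ≡ false
    miss i i< = dec-false (_ Fin.≟ h) λ e → ℕ.<⇒≢ i< (sym (trans
      (cong (p-1 ∸_) (Q-unique (ℕ.m∸n≤m p-1 i)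
        (trans (sym (φ-φ _)) (cong φ (trans (sym (iter-motion i i≤)) e)))))
      (ℕ.m∸[m∸n]≡n i≤)))
      where
      i≤ : i ≤ p-1
      i≤ = ℕ.≤-trans (ℕ.<⇒≤ i<) (ℕ.m∸n≤m p-1 (Q (φ h)))

  pos-internal : ∀ {h} → T h ≡ true → pos M T h ≡ p-1 ∸ Q (α h)
  pos-internal {h} Th = trans (pos≡ h) (cong (λ x → p-1 ∸ Q x) (φ-internal Th))

  pos-external : ∀ {h} → T h ≡ false → pos M T h ≡ p-1 ∸ Q h
  pos-external {h} Th = trans (pos≡ h) (cong (λ x → p-1 ∸ Q x) (φ-external Th))

  pos-internal-α : ∀ {h} → T h ≡ true → pos M T (α h) ≡ p-1 ∸ Q h
  pos-internal-α {h} Th = trans (pos-internal (trans (sym (T-sym h)) Th)) (cong (λ x → p-1 ∸ Q x) (α-inv h))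

  pos-external-α : ∀ {h} → T h ≡ false → pos M T (α h) ≡ p-1 ∸ Q (α h)
  pos-external-α {h} Th = pos-external (trans (sym (T-sym h)) Th)

  -- Two exceptions cancel: `pos` exchanges the halves of internal edges only, and the orientation
  -- rule is opposite on internal and external edges.
  isTail≡ : ∀ h → isTail M T h ≡ (Q h <ᵇ Q (α h))
  isTail≡ h = by-cases (true⊎false (T h))
    where
    branch : Bool → Bool
    branch b = if b then pos M T h <ᵇ pos M T (α h) else pos M T (α h) <ᵇ pos M T h
    by-cases : T h ≡ true ⊎ T h ≡ false → branch (T h) ≡ (Q h <ᵇ Q (α h))
    by-cases (inj₁ Th) = trans (cong branch Th)
      (trans (cong₂ _<ᵇ_ (pos-internal Th) (pos-internal-α Th)) (∸-<ᵇ (Q≤ (α h)) (Q≤ h)))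
    by-cases (inj₂ Th) = trans (cong branch Th)
      (trans (cong₂ _<ᵇ_ (pos-external-α Th) (pos-external Th)) (∸-<ᵇ (Q≤ (α h)) (Q≤ h)))

  -- Reversal turns the smaller half into the one met later, so the minimal edge of a cycle is the
  -- one completed last by the tour.
  key≡ : ∀ h → key M T h ≡ p-1 ∸ (Q h ⊔ Q (α h))
  key≡ h with true⊎false (T h)
  ... | inj₁ Th = trans (cong₂ _⊓_ (pos-internal Th) (pos-internal-α Th))
        (trans (ℕ.⊓-comm _ _) (sym (ℕ.∸-distribˡ-⊔-⊓ p-1 (Q h) (Q (α h)))))
  ... | inj₂ Th = trans (cong₂ _⊓_ (pos-external Th) (pos-external-α Th))
        (sym (ℕ.∸-distribˡ-⊔-⊓ p-1 (Q h) (Q (α h))))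

  notTail : ∀ {h} → isTail M T h ≡ false → Q (α h) < Q h
  notTail {h} e = ℕ.≤∧≢⇒< (ℕ.≮⇒≥ λ h< → true≢false
    (trans (sym (dec-true (Q h ℕ.<? Q (α h)) h<)) (trans (sym (isTail≡ h)) e))) (Q-α h)

  Q<⇒notTail : ∀ {h} → Q (α h) < Q h → isTail M T h ≡ false
  Q<⇒notTail {h} αh<h = trans (isTail≡ h) (dec-false (Q h ℕ.<? Q (α h)) (ℕ.<-asym αh<h))

  early⇒notTail : ∀ {k} → Q (α k) < firstVisit k → isTail M T k ≡ false
  early⇒notTail early = Q<⇒notTail (ℕ.<-≤-trans early (firstVisit-≤Q refl))

  -- Let `g` be the edge by which the vertex of `k` is entered. Then `k` lies beyond `g` and `α k`
  -- before it, so `g` is in the fundamental cycle of `k`. Activity forces `α g` to be met no later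
  -- than `k`, the interval of `g` forces the converse, and `α g ≡ k` would make `k` internal.
  early⇒¬extActive : ∀ {k} → Q (α k) < firstVisit k → ¬ ExtActive M T k
  early⇒¬extActive {k} early (Tk , min) = entered (firstVisit k) refl
    where
    entered : ∀ i → firstVisit k ≡ i → ⊥
    entered zero    e = ℕ.n≮0 (subst (Q (α k) <_) e early)
    entered (suc i) e = true≢false (trans (sym Tg) (trans (T-sym g) (trans (cong T αg≡k) Tk)))
      where
      g : Fin n
      g = q i
      Qg : Q g ≡ i
      Qg = proj₁ (parent k e)
      open Parent (proj₂ (parent k e)) renaming (internal to Tg)
      open Interval Tg tail (cuts g Tg)
      k-in : c (ν k) ≢ c (ν g)
      k-in e′ = αg-in (trans (cong c to) e′)
      αk-out : c (ν (α k)) ≡ c (ν g)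
      αk-out = trans (cong (c ∘ ν) (sym (q-Q (α k))))
        (before (subst (Q (α k) ≤_) (sym Qg) (s≤s⁻¹ (subst (Q (α k) <_) e early))))
      key-≤ : key M T k ≤ key M T g
      key-≤ = min g (swap-spanning tree Tg Tk (cuts g Tg) λ flat → k-in (trans flat αk-out))
      Qαg≤Qk : Q (α g) ≤ Q k
      Qαg≤Qk = ℕ.≮⇒≥ λ k<αg → ℕ.<⇒≱ (ℕ.∸-monoʳ-<
        (ℕ.⊔-lub (ℕ.<-≤-trans k<αg (ℕ.m≤n⊔m (Q g) _))
                 (ℕ.<-≤-trans (ℕ.<-trans αk<k k<αg) (ℕ.m≤n⊔m (Q g) _)))
        (ℕ.⊔-lub (Q≤ g) (Q≤ (α g)))) (subst₂ _≤_ (key≡ k) (key≡ g) key-≤)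
        where
        αk<k : Q (α k) < Q k
        αk<k = ℕ.<-≤-trans early (firstVisit-≤Q refl)
      αg≡k : α g ≡ k
      αg≡k = Q-injective (ℕ.≤-antisym Qαg≤Qk (proj₂ (inside k k-in)))

  -- An internal head would be entered right after its opposite, against the second hypothesis, so
  -- `k` is external. By `key≡` it then remains to see that no edge of its fundamental cycle has a
  -- half met after `k`.
  late⇒extActive : ∀ {k} → isTail M T k ≡ false → firstVisit k ≤ Q (α k) → ExtActive M T k
  late⇒extActive {k} nt late = Tk , min
    where
    αk<k : Q (α k) < Q k
    αk<k = notTail nt
    Tk : T k ≡ false
    Tk with true⊎false (T k)
    ... | inj₂ ext = ext
    ... | inj₁ int = ⊥-elim (ℕ.<-irrefl refl (subst (_≤ Q (α k))
          (trans (cong firstVisit (sym (α-inv k)))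
            (firstVisit-child (trans (sym (T-sym k)) int) (subst (λ x → Q (α k) < Q x) (sym (α-inv k)) αk<k))) late))
    -- An internal edge g that ends after k and separates k from α k is entered after α k has been
    -- met; then so is the vertex of k, against late.
    bounded : ∀ {g} → T g ≡ true → Q g < Q (α g) → (∀ (cut : Cut T g) → ¬ Flat (proj₁ cut) k) →
      Q (α g) ≤ Q k
    bounded {g} Tg tail jump = ℕ.≮⇒≥ contradict
      where
      open Interval Tg tail (cuts g Tg)
      contradict : ¬ (Q k < Q (α g))
      contradict k<αg with c (ν k) Bool.≟ c (ν g)
      -- Here `α k` lies beyond `g`, so `k`, met after `α k` and before `α g`, falls into the same
      -- interval.
      ... | yes k-out = αg-in (trans (sym (between (ℕ.<-trans g<αk αk<k) (ℕ.<⇒≤ k<αg)))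
                          (trans (cong (c ∘ ν) (q-Q k)) k-out))
        where
        g<αk : Q g < Q (α k)
        g<αk = proj₁ (inside (α k) λ αk-out → jump (cuts g Tg) (trans k-out (sym αk-out)))
      -- Here `α k` lies on the near side and must be met no later than `g`, but the vertex of `k`
      -- is entered only after `g`.
      ... | no k-in = ℕ.<⇒≱ g<fv (ℕ.≤-trans late αk≤g)
        where
        αk≤g : Q (α k) ≤ Q g
        αk≤g = ℕ.≮⇒≥ λ g<αk → jump (cuts g Tg) (trans
          (trans (cong (c ∘ ν) (sym (q-Q k))) (between (ℕ.<-trans g<αk αk<k) (ℕ.<⇒≤ k<αg)))
          (trans (sym (between g<αk (ℕ.<⇒≤ (ℕ.<-trans αk<k k<αg)))) (cong (c ∘ ν) (q-Q (α k)))))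
        g<fv : Q g < firstVisit k
        g<fv = ℕ.≰⇒> λ fv≤g → k-in (trans (cong c (sym (firstVisit-visits k))) (before fv≤g))
    min : ∀ e → IsSpanningTree M (swap M T e k) → key M T k ≤ key M T e
    min e sp = subst₂ _≤_ (sym (key≡ k)) (sym (key≡ e))
      (ℕ.∸-monoʳ-≤ p-1 (ℕ.≤-trans end≤ (ℕ.m≤m⊔n (Q k) _)))
      where
      Te : T e ≡ true
      Te = proj₁ (spanning-swap tree Tk sp)
      jump : ∀ (cut : Cut T e) → ¬ Flat (proj₁ cut) k
      jump = proj₂ (spanning-swap tree Tk sp)
      -- `bounded` applies to the tail half of `e`, which may be `α e`; a cut of `α e` is also one
      -- of `e`.
      jump-α : ∀ (cut : Cut T (α e)) → ¬ Flat (proj₁ cut) k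
      jump-α (c , flat , jumps) = jump
        ( c
        , (λ g Tg ¬same → flat g Tg λ same → ¬same (SameEdge-trans (inj₂ refl) same))
        , λ e-flat → jumps (Flat-α {c} e-flat) )
      end≤ : Q e ⊔ Q (α e) ≤ Q k
      end≤ with ℕ.<-cmp (Q e) (Q (α e))
      ... | tri< e< _ _ = subst (_≤ Q k) (sym (ℕ.m≤n⇒m⊔n≡n (ℕ.<⇒≤ e<))) (bounded Te e< jump)
      ... | tri≈ _ e≡ _ = ⊥-elim (Q-α e (sym e≡))
      ... | tri> _ _ e> = subst (_≤ Q k)
              (trans (cong Q (α-inv e)) (sym (ℕ.m≥n⇒m⊔n≡m (ℕ.<⇒≤ e>))))
              (bounded (trans (sym (T-sym e)) Te) (subst (λ x → Q (α e) < Q x) (sym (α-inv e)) e>) jump-α)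

-- Balance of toppling sequences

module Sandpile {n : ℕ} (M : RootedMap n) where
  open Map M

  vertex : Fin n → V M
  vertex h = ν h , ν-idem h

  V-≡ : ∀ {u v : V M} → proj₁ u ≡ proj₁ v → u ≡ v
  V-≡ {x , p} {.x , p′} refl = cong (x ,_) (≡-irrelevant p p′)

  received? : ∀ (P : Fin n → Bool) u →
    Decidable (λ k → ν k ≡ u × ν (α k) ≢ u × P (ν (α k)) ≡ true)
  received? P u k = (ν k Fin.≟ u) ×-dec (¬? (ν (α k) Fin.≟ u) ×-dec (P (ν (α k)) Bool.≟ true))

  -- The grains that reach `u` when every vertex of `P` topples once. Loops are excluded, as they
  -- are in `degStar`.
  received : (Fin n → Bool) → Fin n → ℕ
  received P u = # (received? P u)

  sent : (Fin n → Bool) → V M → ℕ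
  sent P u = if P (proj₁ u) then degStar M u else 0

  -- C arises from S when each vertex in P topples once; stated without subtraction.
  record Toppled (S : Config M) (P : Fin n → Bool) (C : Config M) : Set where
    constructor balanced
    field
      balance : ∀ u → C u + sent P u ≡ S u + received P (proj₁ u)
  open Toppled

  mark : (Fin n → Bool) → Fin n → Fin n → Bool
  mark P v x = P x ∨ (x == v)

  mark-self : ∀ P v → mark P v v ≡ true
  mark-self P v = trans (cong (P v ∨_) (dec-true (v Fin.≟ v) refl)) (Bool.∨-zeroʳ (P v))

  mark-⊇ : ∀ P v {x} → P x ≡ true → mark P v x ≡ true
  mark-⊇ P v {x} e = cong (_∨ (x == v)) e

  mark-other : ∀ P v {x} → x ≢ v → mark P v x ≡ P x
  mark-other P v {x} x≢v = trans (cong (P x ∨_) (dec-false (x Fin.≟ v) x≢v)) (Bool.∨-identityʳ (P x))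

  mark-cases : ∀ P v {x} → mark P v x ≡ true → P x ≡ true ⊎ x ≡ v
  mark-cases P v {x} e with x Fin.≟ v
  ... | yes x≡v = inj₂ x≡v
  ... | no _    = inj₁ (trans (sym (Bool.∨-identityʳ (P x))) e)

  toppled-none : ∀ {S} → Toppled S (λ _ → false) S
  toppled-none {S} = balanced λ u → cong (S u +_)
    (sym (#-none (received? (λ _ → false) (proj₁ u)) λ { h (_ , _ , ()) }))

  received-mono : ∀ {P B} → (∀ x → P x ≡ true → B x ≡ true) → ∀ u → received P u ≤ received B u
  received-mono {P} {B} P⊆B u = #-mono (received? P u) (received? B u)
    λ k (k-at , k-out , k-P) → k-at , k-out , P⊆B _ k-P

  toppled-cong : ∀ {S P P′ C} → (∀ x → ν x ≡ x → P x ≡ P′ x) → Toppled S P C → Toppled S P′ C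
  toppled-cong {S} {P} {P′} {C} P≗P′ inv = balanced λ u → begin
    C u + sent P′ u                ≡⟨ cong (λ b → C u + (if b then degStar M u else 0)) (P≗P′ (proj₁ u) (proj₂ u)) ⟨
    C u + sent P u                 ≡⟨ balance inv u ⟩
    S u + received P (proj₁ u)     ≡⟨ cong (S u +_) (#-cong (received? P (proj₁ u)) (received? P′ (proj₁ u))
                                        (λ k (a , b , c) → a , b , trans (sym (P≗P′ _ (ν-idem (α k)))) c)
                                        (λ k (a , b , c) → a , b , trans (P≗P′ _ (ν-idem (α k))) c)) ⟩
    S u + received P′ (proj₁ u)    ∎
    where open ≡-Reasoning

  degStar≤deg : ∀ v → degStar M v ≤ deg M v
  degStar≤deg v = #-mono (λ k → (ν k Fin.≟ proj₁ v) ×-dec ¬? (ν (α k) Fin.≟ proj₁ v))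
    (λ k → ν k Fin.≟ proj₁ v) (λ _ → proj₁)

  content-unsent : ∀ {S P C} → Toppled S P C → ∀ v → P (proj₁ v) ≡ false → C v ≡ S v + received P (proj₁ v)
  content-unsent {C = C} inv v Pv = trans (sym (ℕ.+-identityʳ (C v)))
    (trans (cong (λ b → C v + (if b then degStar M v else 0)) (sym Pv)) (balance inv v))

  -- The truncated subtraction is exact because `degStar` is at most `deg`. The toppled vertex
  -- itself receives nothing new, and any other vertex gains precisely its edges to `v`.
  toppled-step : ∀ {S P C} → Toppled S P C → ∀ v → P (proj₁ v) ≡ false → deg M v ≤ C v →
    Toppled S (mark P (proj₁ v)) (topple M C v)
  toppled-step {S} {P} {C} inv v Pv ok = balanced at
    where
    at : ∀ u → topple M C v u + sent (mark P (proj₁ v)) u ≡ S u + received (mark P (proj₁ v)) (proj₁ u)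
    at u with proj₁ u Fin.≟ proj₁ v
    ... | yes u≡v with refl ← V-≡ {u} {v} u≡v = begin
      C u ∸ degStar M u + (if P (proj₁ u) ∨ true then degStar M u else 0)
        ≡⟨ cong (λ b → C u ∸ degStar M u + (if b then degStar M u else 0)) (Bool.∨-zeroʳ (P (proj₁ u))) ⟩
      C u ∸ degStar M u + degStar M u
        ≡⟨ ℕ.m∸n+n≡m (ℕ.≤-trans (degStar≤deg u) ok) ⟩
      C u
        ≡⟨ content-unsent inv u Pv ⟩
      S u + received P (proj₁ u)
        ≡⟨ cong (S u +_) (#-cong (received? P (proj₁ u)) (received? (mark P (proj₁ u)) (proj₁ u))
             (λ k (a , b , c) → a , b , mark-⊇ P (proj₁ u) c)
             (λ k (a , b , c) → a , b , trans (sym (mark-other P (proj₁ u) b)) c)) ⟩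
      S u + received (mark P (proj₁ u)) (proj₁ u) ∎
      where open ≡-Reasoning
    ... | no u≢v = begin
      C u + degBetween M u v + (if P (proj₁ u) ∨ false then degStar M u else 0)
        ≡⟨ cong (λ b → C u + degBetween M u v + (if b then degStar M u else 0)) (Bool.∨-identityʳ (P (proj₁ u))) ⟩
      C u + degBetween M u v + sent P u
        ≡⟨ ℕ.+-assoc (C u) (degBetween M u v) (sent P u) ⟩
      C u + (degBetween M u v + sent P u)
        ≡⟨ cong (C u +_) (ℕ.+-comm (degBetween M u v) (sent P u)) ⟩
      C u + (sent P u + degBetween M u v)
        ≡⟨ ℕ.+-assoc (C u) (sent P u) (degBetween M u v) ⟨
      C u + sent P u + degBetween M u v
        ≡⟨ cong (_+ degBetween M u v) (balance inv u) ⟩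
      S u + received P (proj₁ u) + degBetween M u v
        ≡⟨ ℕ.+-assoc (S u) (received P (proj₁ u)) (degBetween M u v) ⟩
      S u + (received P (proj₁ u) + degBetween M u v)
        ≡⟨ cong (S u +_) (#-split (received? P (proj₁ u)) between? (received? (mark P (proj₁ v)) (proj₁ u))
             (λ k (a , b , c) → [ (λ d → inj₁ (a , b , d)) , (λ d → inj₂ (a , d)) ]′ (mark-cases P (proj₁ v) c))
             (λ k (a , b , c) → a , b , mark-⊇ P (proj₁ v) c)
             (λ k (a , b) → a , (λ e → u≢v (trans (sym e) b)) ,
               trans (cong (mark P (proj₁ v)) b) (mark-self P (proj₁ v)))
             (λ k (a , b , c) (_ , d) → true≢false (trans (sym c) (trans (cong P d) Pv)))) ⟨
      S u + received (mark P (proj₁ v)) (proj₁ u) ∎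
      where
      open ≡-Reasoning
      between? : Decidable (λ k → ν k ≡ proj₁ u × ν (α k) ≡ proj₁ v)
      between? k = (ν k Fin.≟ proj₁ u) ×-dec (ν (α k) Fin.≟ proj₁ v)

  -- Each non-loop edge at `u` has brought one grain and taken one away.
  toppled-all : ∀ {S P C} → Toppled S P C → (∀ x → ν x ≡ x → P x ≡ true) → ∀ u → C u ≡ S u
  toppled-all {S} {P} {C} inv all u = ℕ.+-cancelʳ-≡ (degStar M u) (C u) (S u) (begin
    C u + degStar M u            ≡⟨ cong (λ b → C u + (if b then degStar M u else 0)) (all (proj₁ u) (proj₂ u)) ⟨
    C u + sent P u               ≡⟨ balance inv u ⟩
    S u + received P (proj₁ u)   ≡⟨ cong (S u +_) (#-cong (received? P (proj₁ u))
                                      (λ k → (ν k Fin.≟ proj₁ u) ×-dec ¬? (ν (α k) Fin.≟ proj₁ u))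
                                      (λ k (a , b , _) → a , b) (λ k (a , b) → a , b , all _ (ν-idem (α k)))) ⟩
    S u + degStar M u            ∎)
    where open ≡-Reasoning

  -- Dhar's criterion: the first vertex of the toppling order outside B gets enough grains from B.
  burnable : ∀ {S} (B : Fin n → Bool) {P C} → Toppled S P C → (∀ x → P x ≡ true → B x ≡ true) →
    ∀ vs → ValidTopplings M C vs → AllPairs (λ (a b : V M) → proj₁ a ≢ proj₁ b) vs →
    All (λ v → P (proj₁ v) ≡ false) vs →
    All (λ v → B (proj₁ v) ≡ true) vs ⊎
    ∃ λ v → B (proj₁ v) ≡ false × deg M v ≤ S v + received B (proj₁ v)
  burnable B inv P⊆B [] _ _ _ = inj₁ []
  burnable {S} B {P} {C} inv P⊆B (v ∷ vs) (ok , valid) (v≢ ∷ distinct) (Pv ∷ Pvs) with true⊎false (B (proj₁ v))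
  ... | inj₂ Bv = inj₂ (v , Bv , ℕ.≤-trans (subst (deg M v ≤_) (content-unsent inv v Pv) ok)
                              (ℕ.+-monoʳ-≤ (S v) (received-mono {P} {B} P⊆B (proj₁ v))))
  ... | inj₁ Bv with burnable B (toppled-step inv v Pv ok) P′⊆B vs valid distinct P′vs
    where
    P′⊆B : ∀ x → mark P (proj₁ v) x ≡ true → B x ≡ true
    P′⊆B x e = [ P⊆B x , (λ { refl → Bv }) ]′ (mark-cases P (proj₁ v) e)
    P′vs : All (λ u → mark P (proj₁ v) (proj₁ u) ≡ false) vs
    P′vs = All.zipWith (λ { {x} (v≢x , Px) → trans (mark-other P (proj₁ v) (λ e → v≢x (sym e))) Px }) (v≢ , Pvs)
  ... | inj₁ all = inj₁ (Bv ∷ all)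
  ... | inj₂ found = inj₂ found

-- The configuration of a tree: degree minus ρ, and recurrence

module TreeSandpile {n : ℕ} (M : RootedMap n) (T : EdgeSet M) (tree : IsSpanningTree M T) where
  open Map M
  open SpanningTree M T tree public
  open Sandpile M

  early? : ∀ v → Decidable (λ k → ν k ≡ v × Q (α k) < firstVisit v)
  early? v k = (ν k Fin.≟ v) ×-dec (Q (α k) ℕ.<? firstVisit v)

  ρ : Fin n → ℕ
  ρ v = # (early? v)

  upTo? : ∀ v i → Decidable (λ k → ν k ≡ v × Q (α k) ≤ i)
  upTo? v i k = (ν k Fin.≟ v) ×-dec (Q (α k) ℕ.≤? i)

  internal⇒upTo≡ρ : ∀ {h} → Q h < Q (α h) → T h ≡ true → # (upTo? (ν (α h)) (Q h)) ≡ ρ (ν (α h))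
  internal⇒upTo≡ρ {h} tail Th = #-cong (upTo? (ν (α h)) (Q h)) (early? (ν (α h)))
    (λ k (a , b) → a , subst (Q (α k) <_) (sym fv) (s≤s b))
    (λ k (a , b) → a , s≤s⁻¹ (subst (Q (α k) <_) fv b))
    where
    fv : firstVisit (ν (α h)) ≡ suc (Q h)
    fv = trans (firstVisit-cong (ν-idem (α h))) (firstVisit-child Th tail)

  -- If the far end `w` were entered by time `Q h`, the count at `h` would exceed `ρ` by including
  -- `α h`. If it were entered later than the next step, the half at `w` of its entering edge would
  -- still be missing. So `w` is entered right after `h`, hence through `h`.
  upTo≡ρ⇒internal : ∀ {h} → # (upTo? (ν (α h)) (Q h)) ≡ ρ (ν (α h)) → T h ≡ true
  upTo≡ρ⇒internal {h} e = by-cases (firstVisit w) refl (ℕ.<-cmp (firstVisit w) (suc (Q h)))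
    where
    w : Fin n
    w = ν (α h)
    by-cases : ∀ i → firstVisit w ≡ i →
      Tri (firstVisit w < suc (Q h)) (firstVisit w ≡ suc (Q h)) (suc (Q h) < firstVisit w) → T h ≡ true
    by-cases i fv (tri≈ _ fv≡ _) =
      subst (λ x → T x ≡ true) (q-Q h) (Parent.internal (proj₂ (parent w fv≡)))
    by-cases i fv (tri< fv< _ _) = ⊥-elim (ℕ.<⇒≢ (#-strict (early? w) (upTo? w (Q h))
      (λ k (a , b) → a , ℕ.≤-trans (ℕ.<⇒≤ b) (s≤s⁻¹ fv<)) (α h)
      (λ (_ , b) → ℕ.<⇒≱ (subst (λ x → Q x < firstVisit w) (α-inv h) b) (s≤s⁻¹ fv<))
      (refl , ℕ.≤-reflexive (cong Q (α-inv h)))) (sym e))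
    by-cases zero fv (tri> _ _ fv>) = ⊥-elim (ℕ.n≮0 (subst (suc (Q h) <_) fv fv>))
    by-cases (suc i) fv (tri> _ _ fv>) = ⊥-elim (ℕ.<⇒≢ (#-strict (upTo? w (Q h)) (early? w)
      (λ k (a , b) → a , ℕ.≤-<-trans b (ℕ.<-trans (ℕ.n<1+n _) fv>)) (α (q i))
      (λ (_ , b) → ℕ.<⇒≱ (s≤s⁻¹ (subst (suc (Q h) <_) fv fv>)) (subst (_≤ Q h) Qααg b))
      (trans (Parent.to (proj₂ (parent w fv))) (ν-idem (α h)) ,
       subst₂ _<_ (sym Qααg) (sym fv) (ℕ.n<1+n i))) e)
      where
      Qααg : Q (α (α (q i))) ≡ i
      Qααg = trans (cong Q (α-inv (q i))) (proj₁ (parent w fv))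

  private
    tail? : ∀ v → Decidable (λ k → ν k ≡ v × isTail M T k ≡ true)
    tail? v k = (ν k Fin.≟ v) ×-dec (isTail M T k Bool.≟ true)

    -- `ExtActive` quantifies over spanning trees; it is decided by comparing tour times instead.
    active? : ∀ v → Decidable (λ k → ν k ≡ v × isTail M T k ≡ false × ExtActive M T k)
    active? v k = (ν k Fin.≟ v) ×-dec (active-head? (isTail M T k Bool.≟ false) (firstVisit k ℕ.≤? Q (α k)))
      where
      active-head? : Dec (isTail M T k ≡ false) → Dec (firstVisit k ≤ Q (α k)) →
        Dec (isTail M T k ≡ false × ExtActive M T k)
      active-head? (no ¬nt) _          = no (¬nt ∘ proj₁)
      active-head? (yes nt) (yes late) = yes (nt , late⇒extActive nt late)
      active-head? (yes nt) (no early) = no λ (_ , act) → early⇒¬extActive (ℕ.≰⇒> early) act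

    head? : ∀ v → Decidable (λ k → ν k ≡ v × isTail M T k ≡ false)
    head? v k = (ν k Fin.≟ v) ×-dec (isTail M T k Bool.≟ false)

    at-vertex : ∀ {v k} → ν v ≡ v → ν k ≡ v → firstVisit k ≡ firstVisit v
    at-vertex v-rep k-at = firstVisit-cong (trans k-at (sym v-rep))

    -- By the two activity lemmas, the heads that are not external active are the early half-edges.
    deg-split : ∀ v → deg M v ≡ # (tail? (proj₁ v)) + # (active? (proj₁ v)) + ρ (proj₁ v)
    deg-split (v , v-rep) = begin
      deg M (v , v-rep)
        ≡⟨ #-split (tail? v) (head? v) (λ k → ν k Fin.≟ v)
             (λ k k-at → [ (λ e → inj₁ (k-at , e)) , (λ e → inj₂ (k-at , e)) ]′ (true⊎false (isTail M T k)))
             (λ _ → proj₁) (λ _ → proj₁) (λ k (_ , e) (_ , e′) → true≢false (trans (sym e) e′)) ⟩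
      # (tail? v) + # (head? v)
        ≡⟨ cong (# (tail? v) +_) (#-split (active? v) (early? v) (head? v) split
             (λ k (a , b , _) → a , b)
             (λ k (a , b) → a , early⇒notTail (subst (Q (α k) <_) (sym (at-vertex v-rep a)) b))
             (λ k (a , _ , act) (_ , b) → early⇒¬extActive (subst (Q (α k) <_) (sym (at-vertex v-rep a)) b) act)) ⟩
      # (tail? v) + (# (active? v) + ρ v)
        ≡⟨ ℕ.+-assoc (# (tail? v)) _ _ ⟨
      # (tail? v) + # (active? v) + ρ v ∎
      where
      open ≡-Reasoning
      split : ∀ k → ν k ≡ v × isTail M T k ≡ false →
        (ν k ≡ v × isTail M T k ≡ false × ExtActive M T k) ⊎ (ν k ≡ v × Q (α k) < firstVisit v)
      split k (k-at , nt) = by-cases (firstVisit k ℕ.≤? Q (α k))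
        where
        by-cases : Dec (firstVisit k ≤ Q (α k)) →
          (ν k ≡ v × isTail M T k ≡ false × ExtActive M T k) ⊎ (ν k ≡ v × Q (α k) < firstVisit v)
        by-cases (yes late) = inj₁ (k-at , nt , late⇒extActive nt late)
        by-cases (no early) = inj₂ (k-at , subst (Q (α k) <_) (at-vertex v-rep k-at) (ℕ.≰⇒> early))

  isS⇒ρ : ∀ {S} → IsS_T M T S → ∀ v → S v + ρ (proj₁ v) ≡ deg M v
  isS⇒ρ isS v =
    let a , b , (_ , ua , ma , a≡) , (_ , ub , mb , b≡) , e = isS v in trans
    (cong (_+ ρ (proj₁ v)) (trans e (cong₂ _+_
      (trans (sym a≡) (unique-length≡# (tail? (proj₁ v)) ua ma))
      (trans (sym b≡) (unique-length≡# (active? (proj₁ v)) ub mb)))))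
    (sym (deg-split v))

  ρ⇒isS : ∀ {S} → (∀ v → S v + ρ (proj₁ v) ≡ deg M v) → IsS_T M T S
  ρ⇒isS {S} eq v = # (tail? (proj₁ v)) , # (active? (proj₁ v)) ,
    hasCount-# (tail? (proj₁ v)) M T , hasCount-# (active? (proj₁ v)) M T ,
    ℕ.+-cancelʳ-≡ (ρ (proj₁ v)) (S v) _ (trans (eq v) (deg-split v))

  module Recurrence (S : Config M) (S-ρ : ∀ v → S v + ρ (proj₁ v) ≡ deg M v) where

    private
      entered : ℕ → Fin n → Bool
      entered i x = does (firstVisit x ℕ.<? i)

      New : ℕ → Set
      New i = firstVisit (q i) ≡ i

      firstVisit-vertex : ∀ {i} → New i → firstVisit (ν (q i)) ≡ i
      firstVisit-vertex new = trans (firstVisit-cong (ν-idem _)) new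

      at-new : ∀ {i x} → ν x ≡ x → firstVisit x ≡ i → x ≡ ν (q i)
      at-new {x = x} x-rep refl = trans (sym x-rep) (sym (firstVisit-visits x))

      entered-new : ∀ {i} → New i → ∀ x → ν x ≡ x → mark (entered i) (ν (q i)) x ≡ entered (suc i) x
      entered-new {i} new x x-rep = does-⇔ (mk⇔ to from)
        ((firstVisit x ℕ.<? i) ⊎-dec (x Fin.≟ ν (q i))) (firstVisit x ℕ.<? suc i)
        where
        to : firstVisit x < i ⊎ x ≡ ν (q i) → firstVisit x < suc i
        to (inj₁ x<) = ℕ.m≤n⇒m≤1+n x<
        to (inj₂ e)  = s≤s (ℕ.≤-reflexive (trans (cong firstVisit e) (firstVisit-vertex new)))
        from : firstVisit x < suc i → firstVisit x < i ⊎ x ≡ ν (q i)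
        from x<1+i = [ inj₁ , inj₂ ∘ at-new x-rep ]′ (ℕ.m≤n⇒m<n∨m≡n (s≤s⁻¹ x<1+i))

      entered-old : ∀ {i} → ¬ New i → ∀ x → ν x ≡ x → entered i x ≡ entered (suc i) x
      entered-old {i} old x x-rep = does-⇔ (mk⇔ ℕ.m≤n⇒m≤1+n from) (firstVisit x ℕ.<? i) (firstVisit x ℕ.<? suc i)
        where
        from : firstVisit x < suc i → firstVisit x < i
        from x<1+i = ℕ.≤∧≢⇒< (s≤s⁻¹ x<1+i) λ x≡i →
          old (trans (firstVisit-cong (trans (sym (cong (ν ∘ q) x≡i)) (firstVisit-visits x))) x≡i)

      prepend : {A B : Set} → Dec A → B → List B → List B
      prepend (yes _) x xs = x ∷ xs
      prepend (no _)  x xs = xs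

      schedule : ℕ → ℕ → List (V M)
      schedule i zero    = []
      schedule i (suc f) = prepend (firstVisit (q i) ℕ.≟ i) (vertex (q i)) (schedule (suc i) f)

      -- An early half-edge leads to a vertex entered before, which has already toppled and sent a
      -- grain over it. These `ρ` grains fill the gap between `S` and the degree.
      may-topple : ∀ {i C} → New i → Toppled S (entered i) C → deg M (vertex (q i)) ≤ C (vertex (q i))
      may-topple {i} {C} new inv = begin
        deg M v
          ≡⟨ S-ρ v ⟨
        S v + ρ (ν (q i))
          ≤⟨ ℕ.+-monoʳ-≤ (S v) (#-mono (early? (ν (q i))) (received? (entered i) (ν (q i))) early⇒received) ⟩
        S v + received (entered i) (ν (q i))
          ≡⟨ content-unsent inv v (dec-false (_ ℕ.<? i) (ℕ.<-irrefl (firstVisit-vertex new))) ⟨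
        C v ∎
        where
        open ℕ.≤-Reasoning
        v : V M
        v = vertex (q i)
        early⇒received : ∀ k → ν k ≡ ν (q i) × Q (α k) < firstVisit (ν (q i)) →
          ν k ≡ ν (q i) × ν (α k) ≢ ν (q i) × entered i (ν (α k)) ≡ true
        early⇒received k (k-at , early) = k-at ,
          (λ e → ℕ.<⇒≱ early (firstVisit-≤Q (trans e (sym (ν-idem (q i)))))) ,
          dec-true (_ ℕ.<? i) (ℕ.≤-<-trans (firstVisit-≤Q (sym (ν-idem (α k))))
            (subst (Q (α k) <_) (firstVisit-vertex new) early))

      run : ∀ f i C → i + f ≡ suc p-1 → Toppled S (entered i) C →
        ValidTopplings M C (schedule i f) × (∀ v → toppleAll M C (schedule i f) v ≡ S v)
      run zero i C i+f inv = tt , toppled-all inv λ x _ → dec-true (_ ℕ.<? i)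
        (subst (firstVisit x <_) (trans (sym i+f) (ℕ.+-identityʳ i)) (s≤s (firstVisit-≤p x)))
      run (suc f) i C i+f inv = by-cases (firstVisit (q i) ℕ.≟ i)
        where
        next : suc i + f ≡ suc p-1
        next = trans (sym (ℕ.+-suc i f)) i+f
        by-cases : (d : Dec (New i)) → let vs = prepend d (vertex (q i)) (schedule (suc i) f) in
          ValidTopplings M C vs × (∀ v → toppleAll M C vs v ≡ S v)
        by-cases (no old)  = run f (suc i) C next (toppled-cong (entered-old old) inv)
        by-cases (yes new) = (ok , proj₁ rest) , proj₂ rest
          where
          ok : deg M (vertex (q i)) ≤ C (vertex (q i))
          ok = may-topple new inv
          rest : ValidTopplings M (topple M C (vertex (q i))) (schedule (suc i) f) ×
            (∀ v → toppleAll M (topple M C (vertex (q i))) (schedule (suc i) f) v ≡ S v)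
          rest = run f (suc i) _ next (toppled-cong (entered-new new)
            (toppled-step inv (vertex (q i)) (dec-false (_ ℕ.<? i) (ℕ.<-irrefl (firstVisit-vertex new))) ok))

      schedule-≥ : ∀ f i → All (λ v → i ≤ firstVisit (proj₁ v)) (schedule i f)
      schedule-≥ zero    i = []
      schedule-≥ (suc f) i = by-cases (firstVisit (q i) ℕ.≟ i)
        where
        by-cases : (d : Dec (New i)) →
          All (λ v → i ≤ firstVisit (proj₁ v)) (prepend d (vertex (q i)) (schedule (suc i) f))
        by-cases (yes new) = ℕ.≤-reflexive (sym (firstVisit-vertex new)) ∷ All.map ℕ.<⇒≤ (schedule-≥ f (suc i))
        by-cases (no _)    = All.map ℕ.<⇒≤ (schedule-≥ f (suc i))

      schedule-distinct : ∀ f i → AllPairs (λ (a b : V M) → proj₁ a ≢ proj₁ b) (schedule i f)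
      schedule-distinct zero    i = []
      schedule-distinct (suc f) i = by-cases (firstVisit (q i) ℕ.≟ i)
        where
        by-cases : (d : Dec (New i)) → AllPairs (λ (a b : V M) → proj₁ a ≢ proj₁ b)
          (prepend d (vertex (q i)) (schedule (suc i) f))
        by-cases (yes new) =
          All.map (λ i< e → ℕ.<-irrefl (trans (sym (firstVisit-vertex new)) (cong firstVisit e)) i<)
            (schedule-≥ f (suc i)) ∷ schedule-distinct f (suc i)
        by-cases (no _)    = schedule-distinct f (suc i)

      schedule-covers : ∀ f i (v : V M) → i + f ≡ suc p-1 → i ≤ firstVisit (proj₁ v) →
        Any (λ x → proj₁ x ≡ proj₁ v) (schedule i f)
      schedule-covers zero i v i+f i≤ = ⊥-elim (ℕ.<⇒≱ (s≤s (firstVisit-≤p (proj₁ v)))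
        (subst (_≤ firstVisit (proj₁ v)) (trans (sym (ℕ.+-identityʳ i)) i+f) i≤))
      schedule-covers (suc f) i v i+f i≤ = by-cases (firstVisit (q i) ℕ.≟ i) (firstVisit (proj₁ v) ℕ.≟ i)
        where
        later : firstVisit (proj₁ v) ≢ i → Any (λ x → proj₁ x ≡ proj₁ v) (schedule (suc i) f)
        later ≢i = schedule-covers f (suc i) v (trans (sym (ℕ.+-suc i f)) i+f) (ℕ.≤∧≢⇒< i≤ (≢i ∘ sym))
        by-cases : (d : Dec (New i)) → Dec (firstVisit (proj₁ v) ≡ i) →
          Any (λ x → proj₁ x ≡ proj₁ v) (prepend d (vertex (q i)) (schedule (suc i) f))
        by-cases (yes _)  (yes e) = here (sym (at-new (proj₂ v) e))
        by-cases (yes _)  (no ≢i) = there (later ≢i)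
        by-cases (no _)   (no ≢i) = later ≢i
        by-cases (no old) (yes e) = ⊥-elim (old (trans (firstVisit-cong
          (trans (cong (ν ∘ q) (sym e)) (firstVisit-visits (proj₁ v)))) e))

      schedule-0 : schedule 0 (suc p-1) ≡ vertex (q 0) ∷ schedule 1 p-1
      schedule-0 = by-cases (firstVisit (q 0) ℕ.≟ 0)
        where
        by-cases : (d : Dec (New 0)) →
          prepend d (vertex (q 0)) (schedule 1 p-1) ≡ vertex (q 0) ∷ schedule 1 p-1
        by-cases (yes _)  = refl
        by-cases (no old) = ⊥-elim (old (firstVisit-root (q 0) (ν-s⁻ h₀)))

      S-root : ∀ v → IsRoot M v → S v ≡ deg M v
      S-root v v-root = trans (sym (ℕ.+-identityʳ (S v))) (trans (cong (S v +_) (sym ρ≡0)) (S-ρ v))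
        where
        ρ≡0 : ρ (proj₁ v) ≡ 0
        ρ≡0 = #-none (early? (proj₁ v)) λ k (_ , early) → ℕ.n≮0 (subst (Q (α k) <_)
          (firstVisit-root (proj₁ v) (trans (proj₂ v) v-root)) early)

      -- A vertex other than the root is entered through some edge, and the half of that edge at the
      -- vertex is early; so `ρ` is positive.
      S-stable : Stable M S
      S-stable v ¬root = subst (S v <_) (S-ρ v) (ℕ.m<m+n (S v) (positive (firstVisit (proj₁ v)) refl))
        where
        positive : ∀ i → firstVisit (proj₁ v) ≡ i → 0 < ρ (proj₁ v)
        positive zero    e = ⊥-elim (¬root (trans (sym (proj₂ v)) (firstVisit-zero (proj₁ v) e)))
        positive (suc i) e = ℕ.≤-<-trans z≤n (#-strict {P = λ _ → ⊥} (λ _ → no λ ()) (early? (proj₁ v)) (λ _ ())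
          (α g) (λ ()) (trans (Parent.to par) (proj₂ v) ,
            subst₂ _<_ (cong Q (sym (α-inv g))) (sym e) (s≤s (ℕ.≤-reflexive (proj₁ (parent (proj₁ v) e))))))
          where
          g : Fin n
          g = q i
          par : Parent (proj₁ v) g
          par = proj₂ (parent (proj₁ v) e)

    recurrent : Recurrent M S
    recurrent = S-stable , S-root , vertex (q 0) , schedule 1 p-1 , q₀-root ,
      subst (AllPairs _) schedule-0 (schedule-distinct (suc p-1) 0) ,
      (λ v → subst (Any _) schedule-0 (schedule-covers (suc p-1) 0 v refl z≤n)) ,
      subst (ValidTopplings M S) schedule-0 (proj₁ all) ,
      λ v → trans (cong (λ vs → toppleAll M S vs v) (sym schedule-0)) (proj₂ all v)
      where
      q₀-root : IsRoot M (vertex (q 0))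
      q₀-root = ν-s⁻ h₀
      all : ValidTopplings M S (schedule 0 (suc p-1)) × (∀ v → toppleAll M S (schedule 0 (suc p-1)) v ≡ S v)
      all = run (suc p-1) 0 S refl (toppled-cong {P = λ _ → false}
        (λ x _ → sym (dec-false (firstVisit x ℕ.<? 0) λ ())) toppled-none)

-- Reconstruction of the tree from ρ

module Injectivity {n : ℕ} (M : RootedMap n) (T₁ T₂ : EdgeSet M)
  (tree₁ : IsSpanningTree M T₁) (tree₂ : IsSpanningTree M T₂) where
  open Map M

  private
    module A = TreeSandpile M T₁ tree₁
    module B = TreeSandpile M T₂ tree₂

  module _ (ρ≡ : ∀ x → A.ρ (ν x) ≡ B.ρ (ν x)) where

    private
      -- The bounds differ because the position at time `i` is fixed by the decisions taken strictly
      -- before.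
      Agree : ℕ → Set
      Agree i = (∀ {j} → j ≤ i → A.q j ≡ B.q j) × (∀ {j} → j < i → T₁ (A.q j) ≡ T₂ (A.q j))

      module Step {i} (i<n : i < n) (agree : Agree i) where

        A⇒B : ∀ {x} → A.Q x ≤ i → B.Q x ≤ i
        A⇒B {x} x≤i = subst (_≤ i) (sym (B.Q-unique-< (ℕ.≤-<-trans x≤i i<n)
          (trans (sym (proj₁ agree x≤i)) (A.q-Q x)))) x≤i

        B⇒A : ∀ {x} → B.Q x ≤ i → A.Q x ≤ i
        B⇒A {x} x≤i = subst (_≤ i) (sym (A.Q-unique-< (ℕ.≤-<-trans x≤i i<n)
          (trans (proj₁ agree x≤i) (B.q-Q x)))) x≤i

        h : Fin n
        h = A.q i

        QA : A.Q h ≡ i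
        QA = A.Q-unique-< i<n refl

        QB : B.Q h ≡ i
        QB = B.Q-unique-< i<n (sym (proj₁ agree ℕ.≤-refl))

        upTo≡ : # (A.upTo? (ν (α h)) (A.Q h)) ≡ # (B.upTo? (ν (α h)) (B.Q h))
        upTo≡ = #-cong (A.upTo? (ν (α h)) (A.Q h)) (B.upTo? (ν (α h)) (B.Q h))
          (λ k (a , b) → a , subst (_ ≤_) (sym QB) (A⇒B (subst (_ ≤_) QA b)))
          (λ k (a , b) → a , subst (_ ≤_) (sym QA) (B⇒A (subst (_ ≤_) QB b)))

        fresh : i < A.Q (α h) → T₁ h ≡ T₂ h
        fresh i<αh = Bool.⇔→≡ (mk⇔
          (λ T₁h → B.upTo≡ρ⇒internal (trans (sym upTo≡) (trans (A.internal⇒upTo≡ρ tailA T₁h) (ρ≡ (α h)))))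
          (λ T₂h → A.upTo≡ρ⇒internal (trans upTo≡ (trans (B.internal⇒upTo≡ρ tailB T₂h) (sym (ρ≡ (α h)))))))
          where
          tailA : A.Q h < A.Q (α h)
          tailA = subst (_< A.Q (α h)) (sym QA) i<αh
          tailB : B.Q h < B.Q (α h)
          tailB = subst (_< B.Q (α h)) (sym QB) (ℕ.≰⇒> λ αh≤i → ℕ.<⇒≱ i<αh (B⇒A αh≤i))

        -- If the opposite half has been met, the edge was decided then. Otherwise both trees apply
        -- the counting criterion to the same count and the same `ρ`.
        decision : T₁ h ≡ T₂ h
        decision with ℕ.<-cmp (A.Q (α h)) i
        ... | tri< αh<i _ _ = trans (A.T-sym h) (trans
                (subst (λ x → T₁ x ≡ T₂ x) (A.q-Q (α h)) (proj₂ agree αh<i)) (sym (B.T-sym h)))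
        ... | tri≈ _ αh≡i _ = ⊥-elim (A.Q-α h (trans αh≡i (sym QA)))
        ... | tri> _ _ i<αh = fresh i<αh

        next : A.q (suc i) ≡ B.q (suc i)
        next = cong s⁻ (trans (cong (λ b → if b then α h else h) decision)
          (cong (λ x → if T₂ x then α x else x) (proj₁ agree ℕ.≤-refl)))

      agrees : ∀ i → i ≤ n → Agree i
      agrees zero    _   = (λ { z≤n → refl }) , λ ()
      agrees (suc i) i<n = q-agree , T-agree
        where
        agree : Agree i
        agree = agrees i (ℕ.<⇒≤ i<n)
        open Step i<n agree
        q-agree : ∀ {j} → j ≤ suc i → A.q j ≡ B.q j
        q-agree {j} j≤ = [ (λ j< → proj₁ agree (s≤s⁻¹ j<)) , (λ { refl → next }) ]′ (ℕ.m≤n⇒m<n∨m≡n j≤)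
        T-agree : ∀ {j} → j < suc i → T₁ (A.q j) ≡ T₂ (A.q j)
        T-agree {j} j< = [ proj₂ agree , (λ { refl → decision }) ]′ (ℕ.m≤n⇒m<n∨m≡n (s≤s⁻¹ j<))

    ρ-injective : ∀ h → T₁ h ≡ T₂ h
    ρ-injective h = subst (λ x → T₁ x ≡ T₂ x) (A.q-Q h) (proj₂ (agrees n ℕ.≤-refl) (A.Q<n h))

-- Depth-first burning with prescribed thresholds

module Burning {n : ℕ} (M : RootedMap n) (r : Fin n → ℕ)
  (r-root : r (vtx M (RootedMap.h₀ M)) ≡ 0)
  (r-pos : ∀ x → vtx M x ≢ vtx M (RootedMap.h₀ M) → 0 < r (vtx M x)) where
  open Map M
  open Sandpile M

  met? : ∀ (seen : Fin n → Bool) w → Decidable (λ k → ν k ≡ w × seen (α k) ≡ true)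
  met? seen w k = (ν k Fin.≟ w) ×-dec (seen (α k) Bool.≟ true)

  met : (Fin n → Bool) → Fin n → ℕ
  met seen w = # (met? seen w)

  met-mono : ∀ {seen seen′} → (∀ x → seen x ≡ true → seen′ x ≡ true) → ∀ w → met seen w ≤ met seen′ w
  met-mono {seen} {seen′} ⊆ w = #-mono (met? seen w) (met? seen′ w) λ k (a , b) → a , ⊆ _ b

  record State : Set where
    constructor state
    field
      current : Fin n
      seen    : Fin n → Bool
      visited : Fin n → Bool
      tree    : EdgeSet M

    seen′ : Fin n → Bool
    seen′ = mark seen current

    -- The criterion of internal⇒upTo≡ρ, with r in place of ρ.
    Ignites : Set
    Ignites = seen current ≡ false × seen (α current) ≡ false ×
      met seen′ (ν (α current)) ≡ r (ν (α current))

    ignites? : Dec Ignites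
    ignites? = (seen current Bool.≟ false) ×-dec ((seen (α current) Bool.≟ false) ×-dec
      (met seen′ (ν (α current)) ℕ.≟ r (ν (α current))))

    extended : Dec Ignites → EdgeSet M
    extended (yes _) x = tree x ∨ sameEdge? M current x
    extended (no _)    = tree

  open State

  advance : (t : State) → Dec (Ignites t) → State
  advance t d = state next (seen′ t) (mark (visited t) (ν next)) (extended t d)
    where
    next : Fin n
    -- The move uses the enlarged tree, so an ignition carries the walk across the edge at once.
    next = Tour.m M (extended t d) (current t)

  run : ℕ → State
  run zero    = state (s⁻ h₀) (λ _ → false) (_== ν h₀) (λ _ → false)
  run (suc i) = advance (run i) (ignites? (run i))

  -- The last two fields are the heart: a vertex has been visited exactly when its threshold is
  -- reached. The others keep the tree a forest on visited vertices.
  record Invariant (t : State) : Set where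
    field
      tree-sym      : Sym (tree t)
      tree-cuts     : ∀ h → tree t h ≡ true → Cut (tree t) h
      tree-visited  : ∀ h → tree t h ≡ true → visited t (ν h) ≡ true
      current-visited : visited t (ν (current t)) ≡ true
      seen-visited  : ∀ h → seen t h ≡ true → visited t (ν h) ≡ true
      visited⇒met   : ∀ x → visited t (ν x) ≡ true → r (ν x) ≤ met (seen t) (ν x)
      met⇒visited   : ∀ x → r (ν x) ≤ met (seen t) (ν x) → visited t (ν x) ≡ true

  open Invariant

  invariant-start : Invariant (run 0)
  invariant-start = record
    { tree-sym = λ _ → refl
    ; tree-cuts = λ _ ()
    ; tree-visited = λ _ ()
    ; current-visited = dec-true (_ Fin.≟ ν h₀) (ν-s⁻ h₀)
    ; seen-visited = λ _ ()
    -- Nothing has been met yet, so these two fields say that `r` vanishes at the root and only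
    -- there.
    ; visited⇒met = λ x e → subst (_≤ met (λ _ → false) (ν x)) (sym (trans (cong r (root x e)) r-root)) z≤n
    ; met⇒visited = λ x r≤ → dec-true (ν x Fin.≟ ν h₀) (unmet x r≤ (ν x Fin.≟ ν h₀))
    }
    where
    root : ∀ x → (ν x == ν h₀) ≡ true → ν x ≡ ν h₀
    root x e with ν x Fin.≟ ν h₀
    ... | yes e′ = e′
    unmet : ∀ x → r (ν x) ≤ met (λ _ → false) (ν x) → Dec (ν x ≡ ν h₀) → ν x ≡ ν h₀
    unmet x r≤ (yes e) = e
    unmet x r≤ (no ≢) = ⊥-elim (ℕ.<⇒≱ (r-pos x ≢) (subst (r (ν x) ≤_)
      (#-none (met? (λ _ → false) (ν x)) λ { k (_ , ()) }) r≤))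

  module Advance (t : State) (inv : Invariant t) where

    private
      cur w : Fin n
      cur = current t
      w   = ν (α cur)

      seen⊆ : ∀ x → seen t x ≡ true → seen′ t x ≡ true
      seen⊆ x = mark-⊇ (seen t) cur

      met-elsewhere : ∀ {x} → ν x ≢ w → met (seen′ t) (ν x) ≤ met (seen t) (ν x)
      met-elsewhere {x} x≢w = #-mono (met? (seen′ t) (ν x)) (met? (seen t) (ν x))
        λ k (a , b) → a , [ id , (λ e → ⊥-elim (x≢w (trans (sym a)
          (cong ν (trans (sym (α-inv k)) (cong α e)))))) ]′ (mark-cases (seen t) cur b)

    met-suc : ∀ x → met (seen′ t) x ≤ suc (met (seen t) x)
    met-suc x = #-insert (met? (seen t) x) (met? (seen′ t) x) (α cur)
      λ k (a , b) → [ (λ e → inj₁ (a , e)) , (λ e → inj₂ (trans (sym (α-inv k)) (cong α e))) ]′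
        (mark-cases (seen t) cur b)

    private
      module Ignite (ig : Ignites t) where

        t′ : State
        t′ = advance t (yes ig)

        -- Marking the current half-edge raises the count at `w` to exactly `r`, so the threshold
        -- was not reached before. The igniting edge thus leads to a new vertex and hangs it on as a
        -- leaf.
        unvisited : ∀ x → visited t (ν x) ≡ true → ν x ≢ w
        unvisited x vis x≡w = ℕ.<⇒≱ more (subst (_≤ met (seen t) w) (sym (proj₂ (proj₂ ig)))
          (subst (λ y → r y ≤ met (seen t) y) x≡w (visited⇒met inv x vis)))
          where
          more : met (seen t) w < met (seen′ t) w
          more = #-strict (met? (seen t) w) (met? (seen′ t) w) (λ k (a , b) → a , seen⊆ _ b) (α cur)
            (λ (_ , b) → true≢false (trans (sym (trans (cong (seen t) (sym (α-inv cur))) b)) (proj₁ ig)))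
            (refl , trans (cong (seen′ t) (α-inv cur)) (mark-self (seen t) cur))

        new : ∀ {x} → SameEdge′ cur x → tree t′ x ≡ true
        new {x} same = trans (cong (tree t x ∨_) (sameEdge?-yes same)) (Bool.∨-zeroʳ (tree t x))

        old : ∀ {x} → tree t x ≡ true → tree t′ x ≡ true
        old {x} e = cong (_∨ sameEdge? M cur x) e

        tree-cases : ∀ {x} → tree t′ x ≡ true → tree t x ≡ true ⊎ SameEdge′ cur x
        tree-cases {x} e = by-cases (sameEdge cur x)
          where
          by-cases : Dec (SameEdge′ cur x) → tree t x ≡ true ⊎ SameEdge′ cur x
          by-cases (yes same) = inj₂ same
          by-cases (no ¬same) = inj₁ (trans (sym (trans (cong (tree t x ∨_) (sameEdge?-no ¬same))
            (Bool.∨-identityʳ (tree t x)))) e)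

        half : ∀ x → tree t′ x ≡ true → tree t′ (α x) ≡ true
        half x e = [ (λ o → old (trans (sym (tree-sym inv x)) o))
                   , (λ same → new (SameEdge-trans same (inj₂ refl))) ]′ (tree-cases e)

        next-at : ν (current t′) ≡ w
        next-at = trans (ν-s⁻ _) (cong ν (Tour.φ-internal M (tree t′) (new (inj₁ refl))))

        tree-off-w : ∀ x → tree t x ≡ true → ν x ≢ w
        tree-off-w x e = unvisited x (tree-visited inv x e)

        tree-off-wα : ∀ x → tree t x ≡ true → ν (α x) ≢ w
        tree-off-wα x e = tree-off-w (α x) (trans (sym (tree-sym inv x)) e)

        cur-off-w : ν cur ≢ w
        cur-off-w = unvisited cur (current-visited inv)

        cuts : ∀ h → tree t′ h ≡ true → Cut (tree t′) h
        cuts h e = by-cases (tree-cases e)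
          where
          leaf : Fin n → Bool
          leaf = _== w
          by-cases : tree t h ≡ true ⊎ SameEdge′ cur h → Cut (tree t′) h
          -- The new edge is cut off by isolating its leaf `w`.
          by-cases (inj₂ same) = leaf , flat , jump
            where
            flat : ∀ g → tree t′ g ≡ true → ¬ SameEdge′ h g → Flat leaf g
            flat g Tg ¬same = [ (λ o → trans (dec-false (_ Fin.≟ w) (tree-off-w g o))
                                          (sym (dec-false (_ Fin.≟ w) (tree-off-wα g o))))
                              , (λ same′ → ⊥-elim (¬same (SameEdge-trans (SameEdge-sym same) same′))) ]′
              (tree-cases Tg)
            jump : ¬ Flat leaf h
            jump fl = true≢false (trans (sym (dec-true (w Fin.≟ w) refl))
              (trans (sym (Flat-sameEdge {leaf} (SameEdge-sym same) fl)) (dec-false (ν cur Fin.≟ w) cur-off-w)))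
          -- An old cut is kept by giving the leaf the value at its neighbour, which makes the new
          -- edge flat.
          by-cases (inj₁ o) = c′ , flat , jump
            where
            cut : Cut (tree t) h
            cut = tree-cuts inv h o
            c c′ : Fin n → Bool
            c = proj₁ cut
            c′ x = if leaf x then c (ν cur) else c x
            c′-w : c′ w ≡ c (ν cur)
            c′-w = cong (λ b → if b then c (ν cur) else c w) (dec-true (w Fin.≟ w) refl)
            c′-off : ∀ {x} → x ≢ w → c′ x ≡ c x
            c′-off {x} x≢w = cong (λ b → if b then c (ν cur) else c x) (dec-false (x Fin.≟ w) x≢w)
            flat : ∀ g → tree t′ g ≡ true → ¬ SameEdge′ h g → Flat c′ g
            flat g Tg ¬same = [ (λ o′ → trans (c′-off (tree-off-w g o′))
                                  (trans (proj₁ (proj₂ cut) g o′ ¬same) (sym (c′-off (tree-off-wα g o′)))))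
                              , (λ same → Flat-sameEdge {c′} same (trans (c′-off cur-off-w) (sym c′-w))) ]′
              (tree-cases Tg)
            jump : ¬ Flat c′ h
            jump fl = proj₂ (proj₂ cut) (trans (sym (c′-off (tree-off-w h o)))
              (trans fl (c′-off (tree-off-wα h o))))

        vis⊆ : ∀ {x} → visited t x ≡ true → visited t′ x ≡ true
        vis⊆ = mark-⊇ (visited t) (ν (current t′))

        vis-w : visited t′ w ≡ true
        vis-w = subst (λ x → visited t′ x ≡ true) next-at (mark-self (visited t) (ν (current t′)))

        result : Invariant t′
        result = record
          { tree-sym = λ x → Bool.⇔→≡ (mk⇔ (half x) λ e → subst (λ y → tree t′ y ≡ true) (α-inv x) (half (α x) e))
          ; tree-cuts = cuts
          ; tree-visited = λ h e → [ (λ o → vis⊆ (tree-visited inv h o))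
              , (λ { (inj₁ refl) → vis⊆ (current-visited inv) ; (inj₂ refl) → vis-w }) ]′ (tree-cases e)
          ; current-visited = mark-self (visited t) (ν (current t′))
          ; seen-visited = λ h e → [ (λ o → vis⊆ (seen-visited inv h o))
              , (λ { refl → vis⊆ (current-visited inv) }) ]′ (mark-cases (seen t) cur e)
          ; visited⇒met = λ x e → [ (λ o → ℕ.≤-trans (visited⇒met inv x o) (met-mono {seen t} seen⊆ (ν x)))
              , (λ e′ → subst (λ y → r y ≤ met (seen′ t) y) (sym (trans e′ next-at))
                          (ℕ.≤-reflexive (sym (proj₂ (proj₂ ig))))) ]′ (mark-cases (visited t) (ν (current t′)) e)
          ; met⇒visited = λ x r≤ → by-cases x r≤ (ν x Fin.≟ w)
          }
          where
          by-cases : ∀ x → r (ν x) ≤ met (seen′ t) (ν x) → Dec (ν x ≡ w) → visited t′ (ν x) ≡ true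
          by-cases x r≤ (yes e)  = trans (cong (visited t′) e) vis-w
          by-cases x r≤ (no x≢w) = vis⊆ (met⇒visited inv x (ℕ.≤-trans r≤ (met-elsewhere x≢w)))

      module Pass (¬ig : ¬ Ignites t) where

        t′ : State
        t′ = advance t (no ¬ig)

        next-visited : visited t (ν (current t′)) ≡ true
        next-visited = [ (λ Tc → trans (cong (visited t) (trans (ν-s⁻ _) (cong ν (Tour.φ-internal M (tree t) Tc))))
                                  (tree-visited inv (α cur) (trans (sym (tree-sym inv cur)) Tc)))
                       , (λ Tc → trans (cong (visited t) (trans (ν-s⁻ _) (cong ν (Tour.φ-external M (tree t) Tc))))
                                  (current-visited inv)) ]′ (true⊎false (tree t cur))

        vis⊆ : ∀ {x} → visited t x ≡ true → visited t′ x ≡ true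
        vis⊆ = mark-⊇ (visited t) (ν (current t′))

        vis⊇ : ∀ {x} → visited t′ x ≡ true → visited t x ≡ true
        vis⊇ e = [ id , (λ { refl → next-visited }) ]′ (mark-cases (visited t) (ν (current t′)) e)

        result : Invariant t′
        result = record
          { tree-sym = tree-sym inv
          ; tree-cuts = tree-cuts inv
          ; tree-visited = λ h e → vis⊆ (tree-visited inv h e)
          ; current-visited = mark-self (visited t) (ν (current t′))
          ; seen-visited = λ h e → [ (λ o → vis⊆ (seen-visited inv h o))
              , (λ { refl → vis⊆ (current-visited inv) }) ]′ (mark-cases (seen t) cur e)
          ; visited⇒met = λ x e → ℕ.≤-trans (visited⇒met inv x (vis⊇ e)) (met-mono {seen t} seen⊆ (ν x))
          ; met⇒visited = λ x r≤ → vis⊆ (by-cases x r≤ (ν x Fin.≟ w)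
              (true⊎false (seen t cur)) (true⊎false (seen t (α cur))))
          }
          where
          by-cases : ∀ x → r (ν x) ≤ met (seen′ t) (ν x) → Dec (ν x ≡ w) →
            seen t cur ≡ true ⊎ seen t cur ≡ false → seen t (α cur) ≡ true ⊎ seen t (α cur) ≡ false →
            visited t (ν x) ≡ true
          by-cases x r≤ (no x≢w) _ _ = met⇒visited inv x (ℕ.≤-trans r≤ (met-elsewhere x≢w))
          by-cases x r≤ (yes _) (inj₁ again) _ = met⇒visited inv x (ℕ.≤-trans r≤
            (met-mono {seen′ t} (λ y e → [ id , (λ { refl → again }) ]′ (mark-cases (seen t) cur e)) (ν x)))
          by-cases x r≤ (yes e) (inj₂ _) (inj₁ back) = trans (cong (visited t) e) (seen-visited inv (α cur) back)
          -- Without ignition the new count is not `r`. Being at least `r`, it exceeds `r`, and one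
          -- step adds at most one, so `r` was reached before.
          by-cases x r≤ (yes e) (inj₂ f) (inj₂ f′) = met⇒visited inv x (s≤s⁻¹ (ℕ.≤-trans
            (ℕ.≤∧≢⇒< r≤ λ r≡ → ¬ig (f , f′ , sym (subst (λ y → r y ≡ met (seen′ t) y) e r≡))) (met-suc (ν x))))

    invariant-advance : ∀ d → Invariant (advance t d)
    invariant-advance (yes ig) = Ignite.result ig
    invariant-advance (no ¬ig) = Pass.result ¬ig

  invariant : ∀ i → Invariant (run i)
  invariant zero    = invariant-start
  invariant (suc i) = Advance.invariant-advance (run i) (invariant i) (ignites? (run i))

  seen⇒ : ∀ i {x} → seen (run i) x ≡ true → ∃ λ j → j < i × current (run j) ≡ x
  seen⇒ (suc i) e = [ (λ o → let j , j< , e′ = seen⇒ i o in j , ℕ.m≤n⇒m≤1+n j< , e′)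
                    , (λ e′ → i , ℕ.n<1+n i , sym e′) ]′ (mark-cases (seen (run i)) (current (run i)) e)

  ⇒seen : ∀ i {j} → j < i → seen (run i) (current (run j)) ≡ true
  ⇒seen (suc i) j< = [ (λ j<i → mark-⊇ (seen (run i)) (current (run i)) (⇒seen i j<i))
                     , (λ { refl → mark-self (seen (run i)) (current (run i)) }) ]′ (ℕ.m≤n⇒m<n∨m≡n (s≤s⁻¹ j<))

  visited⇒ : ∀ i {x} → visited (run i) x ≡ true → ∃ λ j → j ≤ i × ν (current (run j)) ≡ x
  visited⇒ zero {x} e with x Fin.≟ ν h₀
  ... | yes e′ = 0 , z≤n , trans (ν-s⁻ h₀) (sym e′)
  visited⇒ (suc i) e = [ (λ o → let j , j≤ , e′ = visited⇒ i o in j , ℕ.m≤n⇒m≤1+n j≤ , e′)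
                       , (λ e′ → suc i , ℕ.≤-refl , sym e′) ]′
    (mark-cases (visited (run i)) (ν (current (run (suc i)))) e)

  ⇒visited : ∀ i → visited (run i) (ν (current (run i))) ≡ true
  ⇒visited i = current-visited (invariant i)

  -- An edge is added only while both its halves are unseen, so its status is final once either half
  -- has been met.
  tree-stable : ∀ d i {x} → seen (run i) x ≡ true → tree (run (d + i)) x ≡ tree (run i) x
  tree-stable zero    i e = refl
  tree-stable (suc d) i {x} e = trans (by-cases (ignites? (run (d + i)))) (tree-stable d i e)
    where
    still : ∀ d → seen (run (d + i)) x ≡ true
    still zero    = e
    still (suc d) = mark-⊇ (seen (run (d + i))) (current (run (d + i))) (still d)
    by-cases : ∀ dec → extended (run (d + i)) dec x ≡ tree (run (d + i)) x
    by-cases (no _) = refl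
    by-cases (yes (f , f′ , _)) = trans (cong (tree (run (d + i)) x ∨_) (sameEdge?-no {current (run (d + i))} {x} λ
      { (inj₁ refl) → true≢false (trans (sym (still d)) f)
      ; (inj₂ refl) → true≢false (trans (sym (still d)) f′) })) (Bool.∨-identityʳ _)

  -- Since periods are at most `n`, these `n` steps cover the whole tour.
  T : EdgeSet M
  T = tree (run n)

  open Tour M T

  -- Each move used the status of the current edge at that time, which by `tree-stable` is its
  -- status in `T`.
  q≡current : ∀ {i} → i ≤ n → q i ≡ current (run i)
  q≡current {zero}  _   = refl
  q≡current {suc i} i<n = trans (cong m (q≡current (ℕ.<⇒≤ i<n)))
    (cong (λ b → s⁻ (if b then α cur else cur)) T≡)
    where
    cur : Fin n
    cur = current (run i)
    T≡ : T cur ≡ tree (run (suc i)) cur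
    T≡ = subst (λ k → tree (run k) cur ≡ tree (run (suc i)) cur) (ℕ.m∸n+n≡m i<n)
      (tree-stable (n ∸ suc i) (suc i) (⇒seen (suc i) (ℕ.n<1+n i)))

  T-sym : Sym T
  T-sym = tree-sym (invariant n)

  T-cuts : ∀ h → T h ≡ true → Cut T h
  T-cuts = tree-cuts (invariant n)

  open Orbit T-sym
  open Closed T-cuts

  visited⇒Seen : ∀ {x} → visited (run n) (ν x) ≡ true → Seen x
  visited⇒Seen e = let j , j≤n , e′ = visited⇒ n e in
    seen-vertex (trans (cong ν (q≡current j≤n)) e′) (j , refl)

  Seen⇒seen : ∀ {x} → Seen x → seen (run n) x ≡ true
  Seen⇒seen (i , e) = let j , j<n , e′ = reduce-< i in
    subst (λ y → seen (run n) y ≡ true) (trans (sym (q≡current (ℕ.<⇒≤ j<n))) (trans e′ e)) (⇒seen n j<n)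

  -- The tour exhausts the half-edges of every vertex it visits, so every edge from a visited vertex
  -- has been met from that side.
  received≤met : ∀ w → received (visited (run n)) w ≤ met (seen (run n)) w
  received≤met w = #-mono (received? (visited (run n)) w) (met? (seen (run n)) w)
    λ k (a , _ , b) → a , Seen⇒seen (visited⇒Seen b)

  burns⇒visited : ∀ x → r (ν x) ≤ received (visited (run n)) (ν x) → visited (run n) (ν x) ≡ true
  burns⇒visited x r≤ = met⇒visited (invariant n) x (ℕ.≤-trans r≤ (received≤met (ν x)))

  module Complete (all-visited : ∀ x → visited (run n) (ν x) ≡ true) where

    T-connected : Connected M T
    T-connected h h′ = path⇒walk (path (ν h) (trans (constant-χ h) (trans (sym (constant-χ h′)) base)))
      where
      open Component (component T T-sym (ν h′))
      along : ∀ i → χ (ν (q i)) ≡ χ (ν (q 0))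
      along zero    = refl
      along (suc i) = trans (step-flat χ i (flat (q i))) (along i)
      constant-χ : ∀ x → χ (ν x) ≡ χ (ν (q 0))
      constant-χ x = let i , e = visited⇒Seen (all-visited x) in trans (cong (χ ∘ ν) (sym e)) (along i)

    spanning : IsSpanningTree M T
    spanning = T-sym , T-connected , cuts⇒acyclic T-cuts

    private
      module S = TreeSandpile M T spanning

    ρ≡met : ∀ v i → S.firstVisit v ≡ i → i ≤ n → S.ρ v ≡ met (seen (run i)) v
    ρ≡met v i fv i≤n = #-cong (S.early? v) (met? (seen (run i)) v)
      (λ k (a , b) → a , subst (λ y → seen (run i) y ≡ true)
        (trans (sym (q≡current (ℕ.<⇒≤ (S.Q<n (α k))))) (S.q-Q (α k))) (⇒seen i (subst (S.Q (α k) <_) fv b)))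
      (λ k (a , b) → a , early k (seen⇒ i b))
      where
      early : ∀ k → (∃ λ j → j < i × current (run j) ≡ α k) → S.Q (α k) < S.firstVisit v
      early k (j , j<i , e) = subst₂ _<_ (sym (S.Q-unique-< j<n (trans (q≡current (ℕ.<⇒≤ j<n)) e))) (sym fv) j<i
        where
        j<n : j < n
        j<n = ℕ.<-≤-trans j<i i≤n

    -- On entry the count has reached `r`. One step earlier it had not, or the vertex would have
    -- been visited already; and a step adds at most one. The root has both numbers zero.
    ρ≡r : ∀ x → S.ρ (ν x) ≡ r (ν x)
    ρ≡r x = by-cases (S.firstVisit (ν x)) refl
      where
      fv<n : S.firstVisit (ν x) < n
      fv<n = subst (S.firstVisit (ν x) <_) (sym S.n≡period) (s≤s (S.firstVisit-≤p (ν x)))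
      by-cases : ∀ i → S.firstVisit (ν x) ≡ i → S.ρ (ν x) ≡ r (ν x)
      by-cases zero fv = trans (ρ≡met (ν x) 0 fv z≤n)
        (trans (#-none (met? (λ _ → false) (ν x)) λ { k (_ , ()) })
          (sym (trans (cong r (trans (sym (ν-idem x)) (S.firstVisit-zero (ν x) fv))) r-root)))
      by-cases (suc i) fv = trans (ρ≡met (ν x) (suc i) fv i<n) (ℕ.≤-antisym
        (ℕ.≤-trans (Advance.met-suc (run i) (invariant i) (ν x)) below)
        (visited⇒met (invariant (suc i)) x now))
        where
        i<n : suc i ≤ n
        i<n = subst (_≤ n) fv (ℕ.<⇒≤ fv<n)
        below : met (seen (run i)) (ν x) < r (ν x)
        below = ℕ.≰⇒> λ r≤ →
          let j , j≤i , e = visited⇒ i (met⇒visited (invariant i) x r≤) in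
          ℕ.<⇒≱ (s≤s j≤i) (subst (_≤ j) fv (S.firstVisit-≤
            (trans (cong ν (q≡current (ℕ.≤-trans j≤i (ℕ.<⇒≤ i<n)))) (trans e (sym (ν-idem x))))))
        now : visited (run (suc i)) (ν x) ≡ true
        now = subst (λ y → visited (run (suc i)) y ≡ true)
          (trans (cong ν (sym (q≡current i<n)))
            (trans (subst (λ k → ν (q k) ≡ ν (ν x)) fv (S.firstVisit-visits (ν x))) (ν-idem x)))
          (⇒visited (suc i))

-- Every recurrent configuration comes from a tree

module Surjectivity {n : ℕ} (M : RootedMap n) (S : Config M) (rec : Recurrent M S) where
  open Map M
  open Sandpile M

  private
    stable : Stable M S
    stable = proj₁ rec

    r : Fin n → ℕ
    r x = deg M (vertex x) ∸ S (vertex x)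

    S≤deg : ∀ v → S v ≤ deg M v
    S≤deg v with proj₁ v Fin.≟ ν h₀
    ... | yes root = ℕ.≤-reflexive (proj₁ (proj₂ rec) v root)
    ... | no ¬root = ℕ.<⇒≤ (stable v ¬root)

    r-root : r (ν h₀) ≡ 0
    r-root = trans (cong (deg M v₀ ∸_) (proj₁ (proj₂ rec) v₀ (ν-idem h₀))) (ℕ.n∸n≡0 (deg M v₀))
      where
      v₀ : V M
      v₀ = vertex (ν h₀)

    r-pos : ∀ x → ν x ≢ ν h₀ → 0 < r (ν x)
    r-pos x x≢ = ℕ.m<n⇒0<n∸m (stable (vertex (ν x)) λ e → x≢ (trans (sym (ν-idem x)) e))

    r-vertex : ∀ v → r (ν (proj₁ v)) ≡ deg M v ∸ S v
    r-vertex v = cong (λ u → deg M u ∸ S u) (V-≡ {vertex (ν (proj₁ v))} {v} (trans (ν-idem _) (proj₂ v)))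

  open Burning M r r-root r-pos

  private
    -- Otherwise `burnable` finds an unvisited vertex that gets enough grains from the visited ones.
    -- Its threshold `deg − S` is then reached, so the walk has visited it.
    all-visited : ∀ x → State.visited (run n) (ν x) ≡ true
    all-visited x =
      let w , ws , root , distinct , covers , valid , _ = proj₂ (proj₂ rec) in
      by-cases (covers (vertex x)) (burnable {S} (State.visited (run n)) toppled-none (λ _ ()) (w ∷ ws)
        valid distinct (All.universal (λ _ → refl) (w ∷ ws)))
      where
      pick : ∀ {vs} → Any (λ v → proj₁ v ≡ ν x) vs → All (λ v → State.visited (run n) (proj₁ v) ≡ true) vs →
        State.visited (run n) (ν x) ≡ true
      pick (here e)    (vis ∷ _) = subst (λ y → State.visited (run n) y ≡ true) e vis
      pick (there any) (_ ∷ all) = pick any all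
      by-cases : ∀ {vs} → Any (λ v → proj₁ v ≡ ν x) vs →
        All (λ v → State.visited (run n) (proj₁ v) ≡ true) vs ⊎
        (∃ λ v → State.visited (run n) (proj₁ v) ≡ false ×
          deg M v ≤ S v + received (State.visited (run n)) (proj₁ v)) →
        State.visited (run n) (ν x) ≡ true
      by-cases any (inj₁ all) = pick any all
      by-cases any (inj₂ (v , unvisited , burns)) = ⊥-elim (true≢false (trans
        (sym (burns⇒visited (proj₁ v) (subst₂ _≤_ (sym (r-vertex v))
          (cong (received (State.visited (run n))) (sym (proj₂ v)))
          (ℕ.m≤n+o⇒m∸n≤o (deg M v) (S v) burns))))
        (trans (cong (State.visited (run n)) (proj₂ v)) unvisited)))

  open Complete all-visited

  preimage : Σ (EdgeSet M) λ T → IsSpanningTree M T × IsS_T M T S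
  preimage = T , spanning , TreeSandpile.ρ⇒isS M T spanning λ v → trans
    (cong (S v +_) (trans (cong (TreeSandpile.ρ M T spanning) (sym (proj₂ v))) (trans (ρ≡r (proj₁ v)) (r-vertex v))))
    (ℕ.m+[n∸m]≡n (S≤deg v))

theorem51 : ∀ {n : ℕ} (M : RootedMap n) →
    ((T : EdgeSet M) → IsSpanningTree M T →
    Σ (Config M) λ S → IsS_T M T S × Recurrent M S) ×
    ((T T' : EdgeSet M) (S S' : Config M) →
    IsSpanningTree M T → IsSpanningTree M T' →
    IsS_T M T S → IsS_T M T' S' → (∀ v → S v ≡ S' v) → ∀ h → T h ≡ T' h) ×
    ((S : Config M) → Recurrent M S →
    Σ (EdgeSet M) λ T → IsSpanningTree M T × IsS_T M T S)
theorem51 {n} M = well-defined , injective , Surjectivity.preimage M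
  where
  open Map M
  open Sandpile M

  well-defined : (T : EdgeSet M) → IsSpanningTree M T → Σ (Config M) λ S → IsS_T M T S × Recurrent M S
  well-defined T tree = S , ρ⇒isS S-ρ , Recurrence.recurrent S S-ρ
    where
    open TreeSandpile M T tree
    S : Config M
    S v = deg M v ∸ ρ (proj₁ v)
    S-ρ : ∀ v → S v + ρ (proj₁ v) ≡ deg M v
    S-ρ v = ℕ.m∸n+n≡m (#-mono (early? (proj₁ v)) (λ k → ν k Fin.≟ proj₁ v) (λ _ → proj₁))

  injective : (T T' : EdgeSet M) (S S' : Config M) → IsSpanningTree M T → IsSpanningTree M T' →
    IsS_T M T S → IsS_T M T' S' → (∀ v → S v ≡ S' v) → ∀ h → T h ≡ T' h
  injective T T' S S' tree tree' isS isS' S≡S' = Injectivity.ρ-injective M T T' tree tree' λ x →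
    ℕ.+-cancelˡ-≡ (S (vertex x)) _ _ (trans (TreeSandpile.isS⇒ρ M T tree isS (vertex x))
      (trans (sym (TreeSandpile.isS⇒ρ M T' tree' isS' (vertex x)))
        (cong (_+ TreeSandpile.ρ M T' tree' (ν x)) (sym (S≡S' (vertex x))))))
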